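{- As $n\to\infty$, $g(n,K_3,S_4) = (1+o(1))\dfrac{n}{3}$.
   Context: The Constructor-Blocker game with parameters $n$, a graph $H$ and a graph $F$: Constructor and Blocker alternately claim previously unclaimed edges of $K_n$, Constructor moving first. Constructor may only claim an edge if afterwards her graph (edges she has claimed) contains no subgraph isomorphic to $F$; Blocker may claim any unclaimed edge. The game ends when Constructor cannot claim any more edges or all edges are claimed. The score is the number of copies of $H$ in Constructor's final graph; Constructor maximizes, Blocker minimizes, and $g(n,H,F)$ is the score under optimal play. $K_3$ is the triangle and $S_k$ denotes the star with $k$ leaves (so being $S_4$-free means maximum degree at most $3$). -}

module Defs where

open import Data.Nat using (ℕ; zero; suc; _⊔_; _⊓_; _<ᵇ_; _≤ᵇ_)
open import Data.Bool using (Bool; true; false; _∧_; _∨_; if_then_else_)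
open import Data.Fin using (Fin; toℕ)
open import Data.Fin.Properties using (_≟_)
open import Data.Product using (_×_; _,_)
open import Data.List using (List; []; _∷_; [_]; concatMap; allFin; length; filterᵇ; foldr)
open import Data.Bool.ListAction using (all; any)
open import Data.Vec using (Vec; fromList; removeAt; tabulate; foldr₁)
open import Relation.Nullary.Decidable using (⌊_⌋)

-- An edge of K_n is a pair (i , j) of vertices with i < j.
Edge : ℕ → Set
Edge n = Fin n × Fin n

_=ᶠ_ : ∀ {n} → Fin n → Fin n → Bool
a =ᶠ b = ⌊ a ≟ b ⌋

edgesK : (n : ℕ) → List (Edge n)
edgesK n = concatMap (λ i → concatMap (λ j → if toℕ i <ᵇ toℕ j then [ (i , j) ] else [])
                                      (allFin n))
                     (allFin n)

Graph : ℕ → Set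
Graph n = List (Edge n)

incident : ∀ {n} → Fin n → Edge n → Bool
incident v (a , b) = (v =ᶠ a) ∨ (v =ᶠ b)

degree : ∀ {n} → Graph n → Fin n → ℕ
degree G v = length (filterᵇ (incident v) G)

-- G contains no copy of S_4 (star with 4 leaves) iff every vertex has degree ≤ 3
S4free : ∀ {n} → Graph n → Bool
S4free {n} G = all (λ v → degree G v ≤ᵇ 3) (allFin n)

adj : ∀ {n} → Graph n → Fin n → Fin n → Bool
adj G u v = any (λ { (a , b) → ((a =ᶠ u) ∧ (b =ᶠ v)) ∨ ((a =ᶠ v) ∧ (b =ᶠ u)) }) G

triangles : ∀ {n} → Graph n → ℕ
triangles {n} G =
  length (concatMap (λ i → concatMap (λ j → concatMap (λ k →
      if (toℕ i <ᵇ toℕ j) ∧ (toℕ j <ᵇ toℕ k) ∧ adj G i j ∧ adj G j k ∧ adj G i k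
      then [ (i , j , k) ] else [])
    (allFin n)) (allFin n)) (allFin n))

maxList : List ℕ → ℕ
maxList = foldr _⊔_ 0

-- value of the game position under optimal play.
-- k = number of unclaimed edges, free = the unclaimed edges,
-- turn = true if it is Constructor's turn, C = Constructor's graph.
-- Constructor may claim e only if C ∪ {e} is S4-free; if she has no legal move
-- the game ends. Blocker claims any unclaimed edge. The game also ends when all
-- edges are claimed. Score = number of triangles in C.
value : ∀ {n} (k : ℕ) → Bool → Graph n → Vec (Edge n) k → ℕ
value zero    _     C free = triangles C
value (suc k) true  C free with filterᵇ (λ i → S4free (Data.Vec.lookup free i ∷ C)) (allFin (suc k))
... | []    = triangles C
... | moves = maxList (Data.List.map (λ i → value k false (Data.Vec.lookup free i ∷ C) (removeAt free i)) moves)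
value (suc k) false C free = foldr₁ _⊓_ (tabulate (λ i → value k true C (removeAt free i)))

g : ℕ → ℕ
g n = value (length (edgesK n)) true [] (fromList (edgesK n))

{-# OPTIONS --safe #-}
module Submission where

-- Upper bound.  Blocker keeps Constructor's graph free of diamonds (two triangles sharing an edge).
-- With maximum degree 3, triangles of a diamond-free graph are vertex disjoint, so there are at most
-- n/3 of them.  Call an edge dead when some neighbour of one end can no longer be joined to the other
-- end; a dead edge is never the common edge of a diamond.  Forbidding the pair xv of a path x-u-v
-- kills both xu and uv, and this lets Blocker keep the remaining alive edges a matching: a new edge
-- uv meets at most one alive edge at u and one at v, and one answer handles the resulting path of
-- three edges.
--
-- Lower bound.  Constructor takes fresh vertices c, x, y that Blocker has hardly touched and claims
-- cx and cy.  If Blocker does not take xy, Constructor closes the triangle cxy.  Otherwise she claims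
-- ca, where a comes from a reserve of vertices of degree at most 1, and closes cax or cay; the vertex
-- among x, y left over has degree 1 and replaces a in the reserve.  So each triangle costs exactly
-- three vertices, and only a bounded number plus a small fraction of the vertices is lost.

open import Defs
open import Data.Bool using (Bool; true; false; T; _∧_; if_then_else_)
open import Data.Bool.Properties using (T?; T-∧; T-∨)
open import Data.Empty using (⊥; ⊥-elim)
open import Data.Fin using (Fin; zero; suc; toℕ; inject≤; punchIn; punchOut)
open import Data.Fin.Properties using (_≟_; any?; all?; toℕ-injective; inject≤-injective; punchInᵢ≢i; punchIn-injective; injective⇒≤)
open import Data.List using (List; []; _∷_; [_]; _++_; length; lookup; map; filter; filterᵇ; concatMap; allFin)
open import Data.List.Properties using (length-map; length-tabulate; length-++; length-filter)
open import Data.List.Membership.Propositional using (_∈_; _∉_; lose; find)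
open import Data.List.Membership.Propositional.Properties
open import Data.List.Relation.Binary.Disjoint.Propositional using (Disjoint)
open import Data.List.Relation.Unary.All as All using (All; []; _∷_)
import Data.List.Relation.Unary.All.Properties as Allₚ
open import Data.List.Relation.Unary.AllPairs as AllPairs using (AllPairs; []; _∷_)
import Data.List.Relation.Unary.AllPairs.Properties as AllPairsₚ
open import Data.List.Relation.Unary.Any as Any using (here; there; index)
open import Data.List.Relation.Unary.Any.Properties using (any⁺; any⁻; lookup-index)
open import Data.List.Relation.Unary.Unique.Propositional using (Unique)
open import Data.List.Relation.Unary.Unique.Propositional.Properties using (allFin⁺; concat⁺; map⁺; filter⁺)
open import Data.Nat using (ℕ; zero; suc; _+_; _*_; _∸_; _/_; _⊓_; _≤_; _<_; z≤n; s≤s; _≤?_; _≤ᵇ_; _<ᵇ_; ∣_-_∣)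
open import Data.Nat.DivMod using (/-monoˡ-≤; m*n/n≡m; m/n*n≤m)
open import Data.Nat.ListAction using (sum)
open import Data.Nat.Properties hiding (_≟_; _≤?_)
open import Data.Nat.Tactic.RingSolver using (solve-∀)
open import Data.Product using (_×_; _,_; ∃-syntax; proj₁; proj₂; map₂)
open import Data.Product.Properties using (≡-dec)
open import Data.Sum using (_⊎_; inj₁; inj₂; [_,_]′; swap)
open import Data.Vec as Vec using (Vec; []; _∷_; removeAt; tabulate; foldr₁)
open import Data.Vec.Properties using (removeAt-punchOut)
open import Function using (_∘_; id; Equivalence)
open import Relation.Binary using (tri<; tri≈; tri>)
open import Relation.Binary.PropositionalEquality using (_≡_; _≢_; refl; sym; trans; subst; cong; cong₂; ≢-sym)
open import Relation.Nullary using (¬_; Dec; yes; no)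
open import Relation.Nullary.Decidable using (_×-dec_; _⊎-dec_; _→-dec_; ¬?; map′; toWitness; fromWitness; decidable-stable)

open Equivalence using (to; from)

-- Blocker's answer to a single move

-- A matching of alive edges does not by itself exclude diamonds. If claiming `uv` completes one,
-- then either `uv` is its central edge, and a 4-cycle had an open chord, or `uv` is a side, and the
-- central edge was alive with an end already full. `chord` excludes the first and `fullEnd` the
-- second. This fixes the priorities of Blocker: an open chord of a 4-cycle closed by `uv` comes
-- first, a triangle closed by `uv` second, and the plain path last. The bound `3 * g n ≤ n` holds
-- for every `n`, so the whole error comes from Constructor's side. There `D` is the number of
-- Blocker edges tolerated at a fresh vertex. A triangle takes at most four moves, so after `s`
-- triangles the Blocker degrees sum to at most `8 * s`, and at most `8 * s / (D + 1)` fresh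
-- vertices are spoiled. Letting `D` grow with the wanted precision makes this a small fraction of
-- `n`, while the reserve and the good fresh vertices left at the end are bounded in terms of `D`.

Relation : ℕ → Set₁
Relation n = Fin n → Fin n → Set

module _ {n : ℕ} where

  Full : Relation n → Fin n → Set
  Full A v = ∃[ a ] ∃[ b ] ∃[ c ] (A v a × A v b × A v c × a ≢ b × a ≢ c × b ≢ c)

  -- A stands for Constructor's graph and F for the unclaimed pairs.
  Open : (A F : Relation n) → Relation n
  Open A F p q = F p q × ¬ Full A p × ¬ Full A q

  Linked : (A F : Relation n) → Relation n
  Linked A F p q = A p q ⊎ Open A F p q

  -- An edge is alive if it can still become the central edge of a diamond,
  -- that is, the edge shared by its two triangles.
  Alive : (A F : Relation n) → Relation n
  Alive A F p q = A p q
    × (∀ {t} → A p t → t ≢ q → Linked A F t q)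
    × (∀ {t} → A q t → t ≢ p → Linked A F t p)

  alive-sym : ∀ {A F} → (∀ {a b} → A a b → A b a) → ∀ {p q} → Alive A F p q → Alive A F q p
  alive-sym A-sym (pq , f , g) = A-sym pq , g , f

  MaxDegree3 : Relation n → Set
  MaxDegree3 A = ∀ {v a b c d} → A v a → A v b → A v c → A v d →
    a ≢ b → a ≢ c → a ≢ d → b ≢ c → b ≢ d → c ≢ d → ⊥

  DiamondFree : Relation n → Set
  DiamondFree A = ∀ {p q r s} → A p q → A p r → A q r → A p s → A q s → r ≢ s → ⊥

  -- Forbidding the chord uy of a 4-cycle u x y v can leave a third edge vz alive although v is full.
  -- By fullEnd such a vz is harmless; farApart is what guarantees fullEnd for it.
  record Safe (A F : Relation n) : Set where
    field
      A-sym       : ∀ {p q} → A p q → A q p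
      A-irrefl    : ∀ {p} → ¬ A p p
      F-sym       : ∀ {p q} → F p q → F q p
      F-irrefl    : ∀ {p} → ¬ F p p
      disjoint    : ∀ {p q} → F p q → ¬ A p q
      maxDegree3  : MaxDegree3 A
      diamondFree : DiamondFree A
      matching    : ∀ {p q r} → Alive A F p q → Alive A F p r → q ≡ r
      fullEnd     : ∀ {p q t} → Alive A F p q → Full A p → A p t → t ≢ q →
                    (∃[ c ] (A t c × c ≢ p)) × (∀ {c} → A t c → Full A c)
      chord       : ∀ {p q r s} → A p r → A r q → A q s → A s p → r ≢ s → p ≢ q → ¬ Open A F p q
      farApart    : ∀ {p q r s t} → Alive A F p q → A q r → A r s → Alive A F s t →
                    q ≢ s → p ≢ r → t ≢ r → ¬ Full A q → ¬ Full A r → ¬ Full A s → ⊥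

  open Safe

  twoNeighbours : ∀ (A : Relation n) v {a b} → ¬ Full A v → A v a → A v b → a ≢ b →
    ∀ {c} → A v c → c ≡ a ⊎ c ≡ b
  twoNeighbours A v {a} {b} ¬full va vb a≢b {c} vc with c ≟ a | c ≟ b
  ... | yes e | _     = inj₁ e
  ... | no _  | yes e = inj₂ e
  ... | no ca | no cb = ⊥-elim (¬full (a , b , c , va , vb , vc , a≢b , ≢-sym ca , ≢-sym cb))

  onlyNeighbour : ∀ (A : Relation n) v {a b} → ¬ Full A v → A v a → A v b → a ≢ b →
    ∀ {c} → A v c → c ≢ b → c ≡ a
  onlyNeighbour A v ¬full va vb a≢b vc c≢b with twoNeighbours A v ¬full va vb a≢b vc
  ... | inj₁ e = e
  ... | inj₂ e = ⊥-elim (c≢b e)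

  threeNeighbours : ∀ (A : Relation n) v {a b c} → MaxDegree3 A → A v a → A v b → A v c →
    a ≢ b → a ≢ c → b ≢ c → ∀ {d} → A v d → d ≢ a → d ≡ b ⊎ d ≡ c
  threeNeighbours A v {b = b} {c} deg va vb vc ab ac bc {d} vd da with d ≟ b | d ≟ c
  ... | yes e | _     = inj₁ e
  ... | no _  | yes e = inj₂ e
  ... | no db | no dc = ⊥-elim (deg va vb vc vd ab ac (≢-sym da) bc (≢-sym db) (≢-sym dc))

  anotherNeighbour : ∀ (A : Relation n) v → Full A v → ∀ a b → ∃[ c ] (A v c × c ≢ a × c ≢ b)
  anotherNeighbour A v (x , y , z , vx , vy , vz , xy , xz , yz) a b with x ≟ a | x ≟ b | y ≟ a | y ≟ b
  ... | no xa    | no xb    | _        | _        = x , vx , xa , xb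
  ... | yes refl | _        | _        | no yb    = y , vy , ≢-sym xy , yb
  ... | yes refl | _        | _        | yes refl = z , vz , ≢-sym xz , ≢-sym yz
  ... | _        | yes refl | no ya    | _        = y , vy , ya , ≢-sym xy
  ... | _        | yes refl | yes refl | _        = z , vz , ≢-sym yz , ≢-sym xz

  full? : ∀ {A : Relation n} → (∀ p q → Dec (A p q)) → ∀ v → Dec (Full A v)
  full? A? v = any? λ a → any? λ b → any? λ c →
    A? v a ×-dec A? v b ×-dec A? v c ×-dec ¬? (a ≟ b) ×-dec ¬? (a ≟ c) ×-dec ¬? (b ≟ c)

  -- Effect of one new edge on the invariant

  record Extends (A A′ : Relation n) (u v : Fin n) : Set where
    field
      old   : ∀ {p q} → A p q → A′ p q
      new   : A′ u v
      only  : ∀ {p q} → A′ p q → A p q ⊎ ((p ≡ u × q ≡ v) ⊎ (p ≡ v × q ≡ u))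
      A′-sym : ∀ {p q} → A′ p q → A′ q p

  extends-swap : ∀ {A A′ u v} → Extends A A′ u v → Extends A A′ v u
  extends-swap e = record
    { old = old ; new = A′-sym new ; A′-sym = A′-sym
    ; only = λ pq → [ inj₁ , inj₂ ∘ swap ]′ (only pq) }
    where open Extends e

  record Shrinks (F F″ : Relation n) (u v : Fin n) : Set where
    field
      sub    : ∀ {p q} → F″ p q → F p q
      F″-sym : ∀ {p q} → F″ p q → F″ q p
      taken  : ¬ F″ u v

  -- The pair `a b` may already be claimed, and then Blocker takes any edge at all. Quantifying over
  -- every symmetric `F″` inside `F` without `a b` covers both situations.
  Reply : (A′ F : Relation n) (u v : Fin n) → Set₁
  Reply A′ F u v = ∃[ a ] ∃[ b ] (∀ {F″} → Shrinks F F″ u v → ¬ F″ a b → Safe A′ F″)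

  reply-swap : ∀ {A′ F u v} → Reply A′ F v u → Reply A′ F u v
  reply-swap (a , b , f) = a , b , λ sh → f (record
    { sub = Shrinks.sub sh ; F″-sym = Shrinks.F″-sym sh ; taken = Shrinks.taken sh ∘ Shrinks.F″-sym sh })

  module Step {A A′ F : Relation n} (A? : ∀ p q → Dec (A p q)) (F? : ∀ p q → Dec (F p q))
              (safe : Safe A F) (deg′ : MaxDegree3 A′) {u v : Fin n} (ext : Extends A A′ u v)
              (uvF : F u v) (¬fu : ¬ Full A u) (¬fv : ¬ Full A v) where

    open Extends ext public

    New : Relation n
    New p q = (p ≡ u × q ≡ v) ⊎ (p ≡ v × q ≡ u)

    new-sym : ∀ {p q} → New p q → New q p
    new-sym = [ (λ (e , f) → inj₂ (f , e)) , (λ (e , f) → inj₁ (f , e)) ]′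

    isNew : ∀ {p q} → New p q → A′ p q
    isNew (inj₁ (refl , refl)) = new
    isNew (inj₂ (refl , refl)) = A′-sym new

    u≢v : u ≢ v
    u≢v refl = F-irrefl safe uvF

    ¬uv : ¬ A u v
    ¬uv = disjoint safe uvF

    ¬vu : ¬ A v u
    ¬vu = ¬uv ∘ A-sym safe

    openNew : ∀ {p q} → New p q → Open A F p q
    openNew (inj₁ (refl , refl)) = uvF , ¬fu , ¬fv
    openNew (inj₂ (refl , refl)) = F-sym safe uvF , ¬fv , ¬fu

    ¬new : ∀ {p q} → New p q → ¬ A p q
    ¬new (inj₁ (refl , refl)) = ¬uv
    ¬new (inj₂ (refl , refl)) = ¬vu

    ≢A : ∀ {p q} → A p q → p ≢ q
    ≢A pq refl = A-irrefl safe pq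

    ≢A′ : ∀ {p q} → A′ p q → p ≢ q
    ≢A′ pq with only pq
    ... | inj₁ o                    = ≢A o
    ... | inj₂ (inj₁ (refl , refl)) = u≢v
    ... | inj₂ (inj₂ (refl , refl)) = ≢-sym u≢v

    A′? : ∀ p q → Dec (A′ p q)
    A′? p q = map′
      [ old , isNew ]′ only
      (A? p q ⊎-dec ((p ≟ u ×-dec q ≟ v) ⊎-dec (p ≟ v ×-dec q ≟ u)))

    full-old : ∀ {w} → Full A w → Full A′ w
    full-old (a , b , c , wa , wb , wc , ne) = a , b , c , old wa , old wb , old wc , ne

    stillOld : ∀ {p q a b} → New p q → A′ a b → ¬ (a ≡ p × b ≡ q) → ¬ (a ≡ q × b ≡ p) → A a b
    stillOld nw ab f g with only ab
    ... | inj₁ o = o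
    stillOld (inj₁ (refl , refl)) ab f g | inj₂ (inj₁ e) = ⊥-elim (f e)
    stillOld (inj₁ (refl , refl)) ab f g | inj₂ (inj₂ e) = ⊥-elim (g e)
    stillOld (inj₂ (refl , refl)) ab f g | inj₂ (inj₁ e) = ⊥-elim (g e)
    stillOld (inj₂ (refl , refl)) ab f g | inj₂ (inj₂ e) = ⊥-elim (f e)

    oldAtu : ∀ {x} → A′ u x → x ≢ v → A u x
    oldAtu ux x≢v = stillOld (inj₁ (refl , refl)) ux (x≢v ∘ proj₂) (u≢v ∘ proj₁)

    oldAtv : ∀ {x} → A′ v x → x ≢ u → A v x
    oldAtv vx x≢u = stillOld (inj₂ (refl , refl)) vx (x≢u ∘ proj₂) (u≢v ∘ sym ∘ proj₁)

    oldElse : ∀ {p q} → p ≢ u → p ≢ v → A′ p q → A p q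
    oldElse pu pv pq = stillOld (inj₁ (refl , refl)) pq (pu ∘ proj₁) (pv ∘ proj₁)

    private
      -- Before the move, the sides of the diamond formed a 4-cycle whose chord was open, since it
      -- could be claimed.
      newCentre : ∀ {p q r s} → New p q → A p r → A q r → A p s → A q s → r ≢ s → ⊥
      newCentre nw pr qr ps qs r≢s =
        chord safe pr (A-sym safe qr) qs (A-sym safe ps) r≢s
          (λ { refl → F-irrefl safe (proj₁ (openNew nw)) }) (openNew nw)

      -- The centre `pq` was alive and `q` full, so by `fullEnd` every neighbour of `s` was full.
      -- But `p` is such a neighbour and just received an edge.
      newSide : ∀ {p q r s} → New p r → A p q → A q r → A p s → A q s → r ≢ s → ⊥
      newSide {p} {q} {r} {s} nw pq qr ps qs r≢s =
        ¬full-p (proj₂ (fullEnd safe alive full-q qs (≢-sym (≢A ps))) (A-sym safe ps))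
        where
          p≢r : p ≢ r
          p≢r refl = F-irrefl safe (proj₁ (openNew nw))
          o : Open A F p r
          o = openNew nw
          ¬full-p : ¬ Full A p
          ¬full-p = proj₁ (proj₂ o)
          full-q : Full A q
          full-q = p , r , s , A-sym safe pq , qr , qs , p≢r , ≢A ps , r≢s
          alive : Alive A F q p
          alive = A-sym safe pq
            , (λ qt t≢p → [ (λ { refl → inj₂ (F-sym safe (proj₁ o) , proj₂ (proj₂ o) , ¬full-p) })
                          , (λ { refl → inj₁ (A-sym safe ps) }) ]′
                          (threeNeighbours A q (maxDegree3 safe) (A-sym safe pq) qr qs p≢r (≢A ps) r≢s qt t≢p))
            , (λ pt t≢q → [ (λ { refl → inj₁ (A-sym safe qs) }) , (λ e → ⊥-elim (t≢q e)) ]′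
                          (twoNeighbours A p ¬full-p ps pq (≢-sym (≢A qs)) pt))

    diamondFree′ : DiamondFree A′
    diamondFree′ {p} {q} {r} {s} pq pr qr ps qs r≢s with only pq | only pr | only qr | only ps | only qs
    ... | inj₁ a | inj₁ b | inj₁ c | inj₁ d | inj₁ e = diamondFree safe a b c d e r≢s
    ... | inj₂ nw | _ | _ | _ | _ = newCentre nw
            (stillOld nw pr (≢-sym (≢A′ qr) ∘ proj₂) (≢A′ pq ∘ proj₁))
            (stillOld nw qr (≢-sym (≢A′ pq) ∘ proj₁) (≢-sym (≢A′ pr) ∘ proj₂))
            (stillOld nw ps (≢-sym (≢A′ qs) ∘ proj₂) (≢A′ pq ∘ proj₁))
            (stillOld nw qs (≢-sym (≢A′ pq) ∘ proj₁) (≢-sym (≢A′ ps) ∘ proj₂)) r≢s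
    ... | inj₁ a | inj₂ nw | _ | _ | _ = newSide nw a
            (stillOld nw qr (≢-sym (≢A′ pq) ∘ proj₁) (≢A′ qr ∘ proj₁))
            (stillOld nw ps (≢-sym r≢s ∘ proj₂) (≢A′ pr ∘ proj₁))
            (stillOld nw qs (≢-sym (≢A′ pq) ∘ proj₁) (≢A′ qr ∘ proj₁)) r≢s
    ... | inj₁ a | inj₁ b | inj₂ nw | _ | _ = newSide nw (A-sym safe a) b
            (stillOld nw qs (≢-sym r≢s ∘ proj₂) (≢A′ qr ∘ proj₁))
            (stillOld nw ps (≢A′ pq ∘ proj₁) (≢A′ pr ∘ proj₁)) r≢s
    ... | inj₁ a | inj₁ b | inj₁ c | inj₂ nw | _ = newSide nw a
            (stillOld nw qs (≢-sym (≢A′ pq) ∘ proj₁) (≢A′ qs ∘ proj₁)) b c (≢-sym r≢s)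
    ... | inj₁ a | inj₁ b | inj₁ c | inj₁ d | inj₂ nw =
            newSide nw (A-sym safe a) d c b (≢-sym r≢s)

    module After {F″ : Relation n} (shrinks : Shrinks F F″ u v) where
      open Shrinks shrinks

      Alive″ Open″ : Relation n
      Alive″ = Alive A′ F″
      Open″ = Open A′ F″

      open-old : ∀ {p q} → Open″ p q → Open A F p q
      open-old (pq , fp , fq) = sub pq , fp ∘ full-old , fq ∘ full-old

      -- The new edge was an open pair before the move, so claiming it links nothing that was not
      -- linked. Hence an old edge can lose aliveness but never gain it.
      linked-old : ∀ {p q} → Linked A′ F″ p q → Linked A F p q
      linked-old (inj₂ o) = inj₂ (open-old o)
      linked-old (inj₁ pq) with only pq
      ... | inj₁ o  = inj₁ o
      ... | inj₂ nw = inj₂ (openNew nw)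

      alive-old : ∀ {p q} → Alive″ p q → A p q → Alive A F p q
      alive-old (_ , f , g) pq = pq , (λ pt ne → linked-old (f (old pt) ne))
                                    , (λ qt ne → linked-old (g (old qt) ne))

      sym″ : ∀ {p q} → Alive″ p q → Alive″ q p
      sym″ = alive-sym A′-sym

      open-sym : ∀ {p q} → Open″ p q → Open″ q p
      open-sym (f , a , b) = F″-sym f , b , a

      -- This is the part that depends on Blocker's answer, all of it near `u` and `v`. The last
      -- three fields act at a distance: `apex-u` and `apex-v` keep `fullEnd` true at a common
      -- neighbour of `u` and `v`, and `fullApex` makes an alive `uv` harmless for `farApart`.
      record Obligations : Set where
        field
          chord-u   : ∀ {x y} → A u x → A x y → A y v → ¬ Open″ u y
          chord-v   : ∀ {x y} → A u x → A x y → A y v → ¬ Open″ x v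
          matching-u : ∀ {p q} → Alive″ u p → Alive″ u q → p ≡ q
          matching-v : ∀ {p q} → Alive″ v p → Alive″ v q → p ≡ q
          fullEnd-u : ∀ {q t} → Alive″ u q → Full A′ u → A′ u t → t ≢ q →
                      (∃[ c ] (A′ t c × c ≢ u)) × (∀ {c} → A′ t c → Full A′ c)
          fullEnd-v : ∀ {q t} → Alive″ v q → Full A′ v → A′ v t → t ≢ q →
                      (∃[ c ] (A′ t c × c ≢ v)) × (∀ {c} → A′ t c → Full A′ c)
          apex-u    : ∀ {w} → A u w → A w v → Alive″ w u → ¬ Full A′ w
          apex-v    : ∀ {w} → A u w → A w v → Alive″ w v → ¬ Full A′ w
          fullApex  : ∀ {t} → Alive″ u v → A′ u t ⊎ A′ v t → t ≢ u → t ≢ v → Full A′ t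

      module _ (obl : Obligations) where
        open Obligations obl

        private
          -- A 4-cycle through the new edge is a path `u x y v` closed up, and its only chords are
          -- `uy` and `xv`.
          newChord : ∀ {p q r s} → New p r → A r q → A q s → A s p → ¬ Open″ p q
          newChord (inj₁ (refl , refl)) rq qs sp =
            chord-u (A-sym safe sp) (A-sym safe qs) (A-sym safe rq)
          newChord (inj₂ (refl , refl)) rq qs sp = chord-v rq qs sp ∘ open-sym

          chord″ : ∀ {p q r s} → A′ p r → A′ r q → A′ q s → A′ s p → r ≢ s → p ≢ q → ¬ Open″ p q
          chord″ pr rq qs sp r≢s p≢q o with only pr | only rq | only qs | only sp
          ... | inj₁ a | inj₁ b | inj₁ c | inj₁ d = chord safe a b c d r≢s p≢q (open-old o)
          ... | inj₂ nw | _ | _ | _ = newChord nw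
                  (stillOld nw rq (≢-sym (≢A′ pr) ∘ proj₁) (≢-sym p≢q ∘ proj₂))
                  (stillOld nw qs (≢-sym p≢q ∘ proj₁) (≢-sym (≢A′ rq) ∘ proj₁))
                  (stillOld nw sp (≢A′ sp ∘ proj₁) (≢-sym r≢s ∘ proj₁)) o
          ... | inj₁ a | inj₂ nw | _ | _ = newChord (new-sym nw) (A-sym safe a)
                  (A-sym safe (stillOld nw sp (≢-sym r≢s ∘ proj₁) (≢A′ qs ∘ sym ∘ proj₁)))
                  (A-sym safe (stillOld nw qs (≢-sym (≢A′ rq) ∘ proj₁) (≢-sym r≢s ∘ proj₂))) (open-sym o)
          ... | inj₁ a | inj₁ b | inj₂ nw | _ =
                  newChord nw (stillOld nw sp (≢-sym (≢A′ qs) ∘ proj₁) (p≢q ∘ proj₂)) a b (open-sym o)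
          ... | inj₁ a | inj₁ b | inj₁ c | inj₂ nw =
                  newChord (new-sym nw) (A-sym safe c) (A-sym safe b) (A-sym safe a) o

          matching″ : ∀ {p q r} → Alive″ p q → Alive″ p r → q ≡ r
          matching″ {p} pq pr with p ≟ u | p ≟ v
          ... | yes refl | _ = matching-u pq pr
          ... | no _ | yes refl = matching-v pq pr
          ... | no pu | no pv = matching safe (alive-old pq (oldElse pu pv (proj₁ pq)))
                                              (alive-old pr (oldElse pu pv (proj₁ pr)))

          -- A new edge at t makes t full, so pq can stay alive only if t is adjacent to q; but then q is full.
          noNewEdge : ∀ {p q t c} → Alive″ p q → Alive A F p q → Full A p → A p t → t ≢ q →
                   (∃[ c₀ ] (A t c₀ × c₀ ≢ p)) → (∀ {c} → A t c → Full A c) →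
                   p ≢ c → (New t q → ⊥) → New t c → ⊥
          noNewEdge {p} {q} {t} {c} al al₀ fp pt t≢q (c₀ , tc₀ , c₀≢p) nb p≢c ¬nw nw
            with proj₁ (proj₂ al) (old pt) t≢q
          ... | inj₂ (_ , ¬ft , _) = ¬ft (p , c₀ , c , old (A-sym safe pt) , old tc₀ , isNew nw
                                         , ≢-sym c₀≢p , p≢c , λ { refl → ¬new nw tc₀ })
          ... | inj₁ tq with only tq
          ... | inj₂ n = ¬nw n
          ... | inj₁ tq₀ with anotherNeighbour A p fp q t
          ... | s , ps , s≢q , s≢t with proj₁ (proj₂ al₀) ps s≢q
          ... | inj₁ sq = diamondFree safe (proj₁ al₀) pt (A-sym safe tq₀) ps (A-sym safe sq) (≢-sym s≢t)
          ... | inj₂ (_ , _ , ¬fq) = ¬fq (nb tq₀)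

          fullEnd″ : ∀ {p q t} → Alive″ p q → Full A′ p → A′ p t → t ≢ q →
                     (∃[ c ] (A′ t c × c ≢ p)) × (∀ {c} → A′ t c → Full A′ c)
          fullEnd″ {p} {q} {t} al fp pt t≢q with p ≟ u | p ≟ v
          ... | yes refl | _ = fullEnd-u al fp pt t≢q
          ... | no _ | yes refl = fullEnd-v al fp pt t≢q
          ... | no pu | no pv with fullEnd safe al₀ fp₀ (oldElse pu pv pt) t≢q
            where
              al₀ : Alive A F p q
              al₀ = alive-old al (oldElse pu pv (proj₁ al))
              fp₀ : Full A p
              fp₀ = let (a , b , c , pa , pb , pc , ne) = fp
                    in a , b , c , oldElse pu pv pa , oldElse pu pv pb , oldElse pu pv pc , ne
          ... | ex@(c₀ , tc₀ , c₀≢p) , nb = (c₀ , old tc₀ , c₀≢p) , λ tc → help tc (only tc)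
            where
              pt₀ : A p t
              pt₀ = oldElse pu pv pt
              al₀ : Alive A F p q
              al₀ = alive-old al (oldElse pu pv (proj₁ al))
              fp₀ : Full A p
              fp₀ = let (a , b , c , pa , pb , pc , ne) = fp
                    in a , b , c , oldElse pu pv pa , oldElse pu pv pb , oldElse pu pv pc , ne
              -- If `tq` is the new edge, then `p` is a common neighbour of `u` and `v`, full, and
              -- with an alive edge to one of them.
              ¬nw : New t q → ⊥
              ¬nw (inj₁ (refl , refl)) = apex-v (A-sym safe pt₀) (proj₁ al₀) al fp
              ¬nw (inj₂ (refl , refl)) = apex-u (A-sym safe (proj₁ al₀)) pt₀ al fp
              help : ∀ {c} → A′ t c → A t c ⊎ New t c → Full A′ c
              help _ (inj₁ tc) = full-old (nb tc)
              help _ (inj₂ nw) = ⊥-elim (noNewEdge al al₀ fp₀ pt₀ t≢q ex nb (p≢ nw) ¬nw nw)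
                where p≢ : ∀ {c} → New t c → p ≢ c
                      p≢ (inj₁ (_ , refl)) = pv
                      p≢ (inj₂ (_ , refl)) = pu

          -- With `qr` new, the old graph has no edge at `r` other than `rs`, and `s` has only the
          -- neighbours `r` and `t`, which are linked because `st` is alive. So `rs` was alive too,
          -- against the matching at `s`.
          newFar : ∀ {q r s t} → New q r → A r s → Alive″ s t → A s t →
                   q ≢ s → t ≢ r → ¬ Full A′ r → ¬ Full A′ s → ⊥
          newFar {q} {r} {s} {t} nw rs al st q≢s t≢r ¬fr ¬fs = t≢r (matching safe al₀ (A-sym safe rs , at-s , at-r))
            where
              al₀ : Alive A F s t
              al₀ = alive-old al st
              swapL : ∀ {a b} → Linked A F a b → Linked A F b a
              swapL = [ inj₁ ∘ A-sym safe , (λ (x , y , z) → inj₂ (F-sym safe x , z , y)) ]′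
              at-s : ∀ {x} → A s x → x ≢ r → Linked A F x r
              at-s sx x≢r with onlyNeighbour A′ s ¬fs (old st) (old (A-sym safe rs)) t≢r (old sx) x≢r
              ... | refl = swapL (proj₁ (proj₂ al₀) (A-sym safe rs) (≢-sym t≢r))
              at-r : ∀ {x} → A r x → x ≢ s → Linked A F x s
              at-r rx x≢s with onlyNeighbour A′ r ¬fr (isNew (new-sym nw)) (old rs) q≢s (old rx) x≢s
              ... | refl = ⊥-elim (¬new nw (A-sym safe rx))

          notNew : ∀ {p q r} → Alive″ p q → New p q → A′ q r → p ≢ r → ¬ Full A′ r → ⊥
          notNew al (inj₁ (refl , refl)) qr p≢r ¬fr =
            ¬fr (fullApex al (inj₂ qr) (≢-sym p≢r) (≢-sym (≢A′ qr)))
          notNew al (inj₂ (refl , refl)) qr p≢r ¬fr =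
            ¬fr (fullApex (sym″ al) (inj₁ qr) (≢-sym (≢A′ qr)) (≢-sym p≢r))

          farApart″ : ∀ {p q r s t} → Alive″ p q → A′ q r → A′ r s → Alive″ s t →
                      q ≢ s → p ≢ r → t ≢ r → ¬ Full A′ q → ¬ Full A′ r → ¬ Full A′ s → ⊥
          farApart″ pq qr rs st q≢s p≢r t≢r fq fr fs
            with only (proj₁ pq) | only (proj₁ st) | only qr | only rs
          ... | inj₂ nw | _ | _ | _ = notNew pq nw qr p≢r fr
          ... | _ | inj₂ nw | _ | _ = notNew (sym″ st) (new-sym nw)
                                             (A′-sym rs) t≢r fr
          ... | inj₁ a | inj₁ d | inj₁ b | inj₁ c = farApart safe (alive-old pq a) b c (alive-old st d)
                  q≢s p≢r t≢r (fq ∘ full-old) (fr ∘ full-old) (fs ∘ full-old)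
          ... | inj₁ a | inj₁ d | inj₂ nw | _ = newFar nw
                  (stillOld nw rs (≢-sym (≢A′ qr) ∘ proj₁) (≢-sym q≢s ∘ proj₂)) st d q≢s t≢r fr fs
          ... | inj₁ a | inj₁ d | inj₁ b | inj₂ nw =
                  newFar (new-sym nw) (A-sym safe b)
                  (sym″ pq) (A-sym safe a) (≢-sym q≢s) p≢r fr fq

        preserve : Safe A′ F″
        preserve = record
          { A-sym = A′-sym
          ; A-irrefl = λ pp → ≢A′ pp refl
          ; F-sym = F″-sym
          ; F-irrefl = F-irrefl safe ∘ sub
          ; disjoint = λ f a → [ disjoint safe (sub f)
                               , (λ { (inj₁ (refl , refl)) → taken f ; (inj₂ (refl , refl)) → taken (F″-sym f) }) ]′ (only a)
          ; maxDegree3 = deg′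
          ; diamondFree = diamondFree′
          ; matching = matching″
          ; fullEnd = fullEnd″
          ; chord = chord″
          ; farApart = farApart″
          }

-- The pair that Blocker forbids, by the surroundings of the new edge

module _ {n : ℕ} where
  open Safe

  open? : ∀ {A F : Relation n} → (∀ p q → Dec (A p q)) → (∀ p q → Dec (F p q)) → ∀ p q → Dec (Open A F p q)
  open? A? F? p q = F? p q ×-dec ¬? (full? A? p) ×-dec ¬? (full? A? q)

  alive? : ∀ {A F : Relation n} → (∀ p q → Dec (A p q)) → (∀ p q → Dec (F p q)) → ∀ p q → Dec (Alive A F p q)
  alive? {A} {F} A? F? p q = map′
    (λ (a , f , g) → a , (λ {t} → f t) , (λ {t} → g t))
    (λ (a , f , g) → a , (λ t → f {t}) , (λ t → g {t}))
    (A? p q ×-dec side p q ×-dec side q p)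
    where
      side : ∀ a b → Dec (∀ t → A a t → t ≢ b → Linked A F t b)
      side a b = all? λ t → A? a t →-dec (¬? (t ≟ b) →-dec (A? t b ⊎-dec open? A? F? t b))

  module Respond {A A′ F : Relation n} (A? : ∀ p q → Dec (A p q)) (F? : ∀ p q → Dec (F p q))
                 (safe : Safe A F) (deg′ : MaxDegree3 A′) {u v : Fin n} (ext : Extends A A′ u v)
                 (uvF : F u v) (¬fu : ¬ Full A u) (¬fv : ¬ Full A v) where

    open Step A? F? safe deg′ ext uvF ¬fu ¬fv public

    private
      A-sy : ∀ {p q} → A p q → A q p
      A-sy = A-sym safe

      openSym : ∀ {B : Relation n} {p q} → Open B F p q → Open B F q p
      openSym (f , a , b) = F-sym safe f , b , a

      open-A : ∀ {p q} → Open A′ F p q → Open A F p q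
      open-A (f , a , b) = f , a ∘ full-old , b ∘ full-old

    -- Forbidding `uy` kills the edges at `u` and the edge `vy`: each has `u` or `y` at one end, and
    -- its other end is adjacent to both. As `u` and `y` are not full, their neighbours are just `x`
    -- and `v`, so the only edge at `v` that can stay alive is a third one leaving the cycle.
    chordReply : ∀ {x y} → A u x → A x y → A y v → Open A′ F u y → Reply A′ F u v
    chordReply {x} {y} ux xy yv o@(_ , ¬fu′ , ¬fy′) = u , y , λ sh ¬uy → After.preserve sh (obligations sh ¬uy)
      where
        x≢v : x ≢ v
        x≢v refl = ¬uv ux
        u≢y : u ≢ y
        u≢y refl = ¬uv yv
        at-u : ∀ {c} → A′ u c → c ≢ v → c ≡ x
        at-u = onlyNeighbour A′ u ¬fu′ (old ux) new x≢v
        at-u₀ : ∀ {c} → A u c → c ≡ x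
        at-u₀ uc = at-u (old uc) (λ { refl → ¬uv uc })
        at-y : ∀ {c} → A′ y c → c ≢ v → c ≡ x
        at-y = onlyNeighbour A′ y ¬fy′ (old (A-sy xy)) (old yv) x≢v
        alive-ux : (∀ {t} → A x t → t ≢ u → Linked A F t u) → Alive A F x u
        alive-ux f = A-sy ux , f , (λ ut t≢x → ⊥-elim (t≢x (at-u₀ ut)))
        ¬apex : ¬ A x v
        ¬apex xv = diamondFree′ (old xv) (old (A-sy ux)) (A′-sym new) (old xy) (old (A-sy yv)) u≢y
        obligations : ∀ {F″} (sh : Shrinks F F″ u v) → ¬ F″ u y → After.Obligations sh
        obligations {F″} sh ¬uy = record
          { chord-u = chord-u
          ; chord-v = chord-v
          ; matching-u = λ up → ⊥-elim (dead-u up)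
          ; matching-v = matching-v
          ; fullEnd-u = λ al → ⊥-elim (dead-u al)
          ; fullEnd-v = fullEnd-v
          ; apex-u = λ uw wv → ⊥-elim (¬apex (subst (λ w → A w v) (at-u₀ uw) wv))
          ; apex-v = λ uw wv → ⊥-elim (¬apex (subst (λ w → A w v) (at-u₀ uw) wv))
          ; fullApex = λ al → ⊥-elim (dead-u al)
          }
          where
            open After sh
            open Shrinks sh
            ¬link : ¬ Linked A′ F″ y u
            ¬link (inj₁ yu) = ≢A xy (sym (at-u (A′-sym yu) (≢A yv)))
            ¬link (inj₂ (yu , _)) = ¬uy (F″-sym yu)
            ¬link′ : ¬ Linked A′ F″ u y
            ¬link′ (inj₁ uy) = ¬link (inj₁ (A′-sym uy))
            ¬link′ (inj₂ (uy , _)) = ¬uy uy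
            dead-u : ∀ {p} → ¬ Alive″ u p
            dead-u {p} al with p ≟ v
            ... | yes refl = ¬link (proj₂ (proj₂ al) (old (A-sy yv)) (≢-sym u≢y))
            ... | no p≢v with at-u (proj₁ al) p≢v
            ... | refl = ¬link (proj₂ (proj₂ al) (old xy) (≢-sym u≢y))
            dead-vy : ¬ Alive″ v y
            dead-vy al = ¬link′ (proj₁ (proj₂ al) (A′-sym new) u≢y)
            alive≢ : ∀ {p} → Alive″ v p → p ≢ u × p ≢ y
            alive≢ al = (λ { refl → dead-u (sym″ al) }) , (λ { refl → dead-vy al })
            oldAlive : ∀ {p} → Alive″ v p → A v p
            oldAlive al = oldAtv (proj₁ al) (proj₁ (alive≢ al))
            matching-v : ∀ {p q} → Alive″ v p → Alive″ v q → p ≡ q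
            matching-v {p} {q} ap aq with p ≟ q
            ... | yes e = e
            ... | no p≢q = ⊥-elim (¬fv (y , p , q , A-sy yv , oldAlive ap , oldAlive aq
                                  , ≢-sym (proj₂ (alive≢ ap)) , ≢-sym (proj₂ (alive≢ aq)) , p≢q))
            fullEnd-v : ∀ {q t} → Alive″ v q → Full A′ v → A′ v t → t ≢ q →
                        (∃[ c ] (A′ t c × c ≢ v)) × (∀ {c} → A′ t c → Full A′ c)
            fullEnd-v {q} {t} al fv′ vt t≢q = result
              (threeNeighbours A′ v deg′ (proj₁ al) (A′-sym new) (old (A-sy yv))
                               (proj₁ (alive≢ al)) (proj₂ (alive≢ al)) u≢y vt t≢q)
              where
                -- Otherwise `u` and `y` are the only neighbours of `x`, so `xu` was alive before
                -- the move, and so was `vq`. The path `x y v` between them would have no full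
                -- vertex, against `farApart`.
                full-x : Full A′ x
                full-x with full? A′? x
                ... | yes f = f
                ... | no ¬fx = ⊥-elim (farApart safe (alive-sym A-sy (alive-ux at-x)) xy yv (alive-old al (oldAlive al))
                                  x≢v u≢y (proj₂ (alive≢ al)) ¬fx₀ (¬fy′ ∘ full-old) ¬fv)
                  where
                    ¬fx₀ : ¬ Full A x
                    ¬fx₀ = ¬fx ∘ full-old
                    at-x : ∀ {t} → A x t → t ≢ u → Linked A F t u
                    at-x xt t≢u with onlyNeighbour A x ¬fx₀ xy (A-sy ux) (≢-sym u≢y) xt t≢u
                    ... | refl = inj₂ (open-A (openSym o))
                result : t ≡ u ⊎ t ≡ y → (∃[ c ] (A′ t c × c ≢ v)) × (∀ {c} → A′ t c → Full A′ c)
                result (inj₁ refl) = (x , old ux , x≢v) , help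
                  where help : ∀ {c} → A′ u c → Full A′ c
                        help {c} uc with c ≟ v
                        ... | yes refl = fv′
                        ... | no c≢v = subst (Full A′) (sym (at-u uc c≢v)) full-x
                result (inj₂ refl) = (x , old (A-sy xy) , x≢v) , help
                  where help : ∀ {c} → A′ y c → Full A′ c
                        help {c} yc with c ≟ v
                        ... | yes refl = fv′
                        ... | no c≢v = subst (Full A′) (sym (at-y yc c≢v)) full-x
            -- A second open chord `u y₁` would mean that `x` was full and `xu` alive before the
            -- move. Then `fullEnd` would make `v`, a neighbour of `y`, full.
            chord-u : ∀ {x y} → A u x → A x y → A y v → ¬ Open″ u y
            chord-u {_} {y₁} ux₁ xy₁ yv₁ o₁ with at-u₀ ux₁ | y₁ ≟ y
            ... | refl | yes refl = ¬uy (proj₁ o₁)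
            ... | refl | no y₁≢y = ¬fv (proj₂ (fullEnd safe (alive-ux at-x) full-x xy (≢-sym u≢y)) yv)
              where
                u≢y₁ : u ≢ y₁
                u≢y₁ refl = ¬uv yv₁
                full-x : Full A x
                full-x = u , y , y₁ , A-sy ux , xy , xy₁ , u≢y , u≢y₁ , ≢-sym y₁≢y
                at-x : ∀ {t} → A x t → t ≢ u → Linked A F t u
                at-x xt t≢u with threeNeighbours A x (maxDegree3 safe) (A-sy ux) xy xy₁ u≢y u≢y₁ (≢-sym y₁≢y) xt t≢u
                ... | inj₁ refl = inj₂ (open-A (openSym o))
                ... | inj₂ refl = inj₂ (open-old (open-sym o₁))
            -- Were both chords open, `xu` and `xy` would both have been alive, against the matching
            -- at `x`.
            chord-v : ∀ {x y} → A u x → A x y → A y v → ¬ Open″ x v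
            chord-v {_} {y₁} ux₁ xy₁ yv₁ o₁@(_ , ¬fx′ , ¬fv′) with at-u₀ ux₁
            ... | refl = u≢y (matching safe (alive-ux at-x) alive-xy)
              where
                at-x : ∀ {t} → A x t → t ≢ u → Linked A F t u
                at-x xt t≢u with onlyNeighbour A x (¬fx′ ∘ full-old) xy (A-sy ux) (≢-sym u≢y) xt t≢u
                ... | refl = inj₂ (open-A (openSym o))
                alive-xy : Alive A F x y
                alive-xy = xy , from-x , from-y
                  where
                    from-x : ∀ {t} → A x t → t ≢ y → Linked A F t y
                    from-x xt t≢y with onlyNeighbour A x (¬fx′ ∘ full-old) (A-sy ux) xy u≢y xt t≢y
                    ... | refl = inj₂ (open-A o)
                    from-y : ∀ {t} → A y t → t ≢ x → Linked A F t x
                    from-y yt t≢x with onlyNeighbour A y (¬fy′ ∘ full-old) yv (A-sy xy) (≢-sym x≢v) yt t≢x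
                    ... | refl = inj₂ (openSym (open-old o₁))

    NoChord : Set
    NoChord = ∀ {x y} → A u x → A x y → A y v → ¬ Open A′ F u y × ¬ Open A′ F x v

    NoApex : Set
    NoApex = ∀ {w} → A u w → ¬ A w v

    -- The pair `xv` leaves nothing alive at `u`; the condition `side` settles `v`. If `u` is full,
    -- then `u` is neither adjacent nor open to another neighbour of `v`, so every edge at `v` is
    -- dead. If `v` is not full, it has at most one edge besides the dead `uv`, and `fullEnd` is
    -- vacuous there.
    pathReply : ∀ {x} → NoChord → NoApex → A u x → (∀ {p} → Alive A F u p → p ≡ x) →
                Full A′ u ⊎ ¬ Full A′ v → Reply A′ F u v
    pathReply {x} noChord noApex ux only-x side = x , v , λ sh ¬xv → After.preserve sh (obligations sh ¬xv)
      where
        obligations : ∀ {F″} (sh : Shrinks F F″ u v) → ¬ F″ x v → After.Obligations sh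
        obligations {F″} sh ¬xv = record
          { chord-u = λ a b c o → proj₁ (noChord a b c) (weaken o)
          ; chord-v = λ a b c o → proj₂ (noChord a b c) (weaken o)
          ; matching-u = λ up → ⊥-elim (dead-u up)
          ; matching-v = matching-v side
          ; fullEnd-u = λ al → ⊥-elim (dead-u al)
          ; fullEnd-v = λ al f → ⊥-elim ([ (λ fu → dead-v fu al) , (λ ¬f → ¬f f) ]′ side)
          ; apex-u = λ uw wv → ⊥-elim (noApex uw wv)
          ; apex-v = λ uw wv → ⊥-elim (noApex uw wv)
          ; fullApex = λ al → ⊥-elim (dead-u al)
          }
          where
            open After sh
            open Shrinks sh
            weaken : ∀ {p q} → Open″ p q → Open A′ F p q
            weaken (f , g) = sub f , g
            x≢v : x ≢ v
            x≢v refl = ¬uv ux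
            x≢u : x ≢ u
            x≢u = ≢-sym (≢A ux)
            ¬link : ¬ Linked A′ F″ x v
            ¬link (inj₁ xv) = noApex ux (oldElse x≢u x≢v xv)
            ¬link (inj₂ (xv , _)) = ¬xv xv
            dead-u : ∀ {p} → ¬ Alive″ u p
            dead-u {p} al with p ≟ v
            ... | yes refl = ¬link (proj₁ (proj₂ al) (old ux) x≢v)
            ... | no p≢v with only-x (alive-old al (oldAtu (proj₁ al) p≢v))
            ... | refl with proj₁ (proj₂ al) new (≢-sym x≢v)
            ... | inj₁ vx = ¬link (inj₁ (A′-sym vx))
            ... | inj₂ (vx , _) = ¬xv (F″-sym vx)
            dead-v : Full A′ u → ∀ {p} → ¬ Alive″ v p
            dead-v fu′ {p} al with p ≟ u
            ... | yes refl = dead-u (sym″ al)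
            ... | no p≢u with proj₁ (proj₂ al) (A′-sym new) (≢-sym p≢u)
            ... | inj₁ up = noApex (oldAtu up (≢-sym (≢A′ (proj₁ al)))) (A-sy (oldAtv (proj₁ al) p≢u))
            ... | inj₂ (_ , ¬fu′ , _) = ¬fu′ fu′
            matching-v : Full A′ u ⊎ ¬ Full A′ v → ∀ {p q} → Alive″ v p → Alive″ v q → p ≡ q
            matching-v (inj₁ fu′) ap = ⊥-elim (dead-v fu′ ap)
            matching-v (inj₂ ¬fv′) ap aq = sym (onlyNeighbour A′ v ¬fv′ (proj₁ ap) (A′-sym new)
              (λ { refl → dead-u (sym″ ap) }) (proj₁ aq) (λ { refl → dead-u (sym″ aq) }))

    -- Nothing needs forbidding when `uv` is a component of its own; the taken pair `u v` is a dummy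
    -- answer.
    isolatedReply : NoChord → (∀ {x} → ¬ A u x) → (∀ {y} → ¬ A v y) → Reply A′ F u v
    isolatedReply noChord ¬u ¬v = u , v , λ sh _ → After.preserve sh (record
      { chord-u = λ ux → ⊥-elim (¬u ux)
      ; chord-v = λ ux → ⊥-elim (¬u ux)
      ; matching-u = λ p q → trans (at-u (proj₁ p)) (sym (at-u (proj₁ q)))
      ; matching-v = λ p q → trans (at-v (proj₁ p)) (sym (at-v (proj₁ q)))
      ; fullEnd-u = λ al f ut t≢q → ⊥-elim (t≢q (trans (at-u ut) (sym (at-u (proj₁ al)))))
      ; fullEnd-v = λ al f ut t≢q → ⊥-elim (t≢q (trans (at-v ut) (sym (at-v (proj₁ al)))))
      ; apex-u = λ ux → ⊥-elim (¬u ux)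
      ; apex-v = λ ux → ⊥-elim (¬u ux)
      ; fullApex = λ _ t t≢u t≢v → ⊥-elim ([ (λ ut → t≢v (at-u ut)) , (λ vt → t≢u (at-v vt)) ]′ t)
      })
      where
        at-u : ∀ {c} → A′ u c → c ≡ v
        at-u {c} uc with c ≟ v
        ... | yes e = e
        ... | no c≢v = ⊥-elim (¬u (oldAtu uc c≢v))
        at-v : ∀ {c} → A′ v c → c ≡ u
        at-v {c} vc with c ≟ u
        ... | yes e = e
        ... | no c≢u = ⊥-elim (¬v (oldAtv vc c≢u))

    -- The neighbour `x` is the alive one if `u` has one, so that a single pair kills both that edge
    -- and `uv`. Without an alive edge at `u` any other neighbour does.
    fullReply : NoChord → NoApex → Full A′ u → Reply A′ F u v
    fullReply noChord noApex fu′ with any? (alive? A? F? u)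
    ... | yes (x , al) = pathReply noChord noApex (proj₁ al) (λ al′ → matching safe al′ al) (inj₁ fu′)
    ... | no none with anotherNeighbour A′ u fu′ v v
    ... | x , ux , x≢v , _ = pathReply noChord noApex (oldAtu ux x≢v) (λ al → ⊥-elim (none (_ , al))) (inj₁ fu′)

    thinReply : ∀ {x} → NoChord → NoApex → ¬ Full A′ u → ¬ Full A′ v → A u x → Reply A′ F u v
    thinReply noChord noApex ¬fu′ ¬fv′ ux = pathReply noChord noApex ux
      (λ al → onlyNeighbour A′ u ¬fu′ (old ux) new (λ { refl → ¬uv ux }) (old (proj₁ al))
                (λ { refl → ¬uv (proj₁ al) })) (inj₂ ¬fv′)

    -- The move closes the triangle `u v w`, of which only `uv` and `uw` can be alive, `vw` being
    -- dead. It suffices that whichever of them stays alive has no full end; `obligations` derives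
    -- everything from that, and the rest finds one pair that enforces it.
    apexReply : ∀ {w} → NoChord → A u w → A w v → ¬ Alive A F v w → Reply A′ F u v
    apexReply {w} noChord uw wv ¬vw = choose
      where
        w≢u : w ≢ u
        w≢u = ≢-sym (≢A uw)
        w≢v : w ≢ v
        w≢v = ≢A wv
        uw′ : A′ u w
        uw′ = old uw
        wv′ : A′ w v
        wv′ = old wv
        vu′ : A′ v u
        vu′ = A′-sym new

        module _ {F″ : Relation n} (sh : Shrinks F F″ u v) where
          open After sh
          open Shrinks sh

          weaken : ∀ {p q} → Open″ p q → Open A′ F p q
          weaken (f , g) = sub f , g

          -- In a triangle `p q r`, only the edge `tq` separates `pq` from being the centre of a
          -- diamond. Since `tq` is open, `q` is not full, so it has no neighbour outside the
          -- triangle that could be in the way.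
          threat⇒alive : ∀ {p q r t} → A′ p q → A′ p r → A′ q r → A′ p t → t ≢ q → t ≢ r →
                         Open″ t q → Alive″ p q
          threat⇒alive {p} {q} pq pr qr pt t≢q t≢r o@(_ , _ , ¬fq) = pq
            , (λ ps s≢q → [ (λ { refl → inj₁ (A′-sym qr) }) , (λ { refl → inj₂ o }) ]′
                            (threeNeighbours A′ p deg′ pq pr pt (≢A′ qr) (≢-sym t≢q) (≢-sym t≢r) ps s≢q))
            , (λ qs s≢p → inj₁ (subst (λ s → A′ s p)
                            (sym (onlyNeighbour A′ q ¬fq qr (A′-sym pq) (≢-sym (≢A′ pr)) qs s≢p)) (A′-sym pr)))

          -- The alternative to an open `tq` is a claimed one, and that would already be a diamond.
          alive⇒threat : ∀ {p q r t} → Alive″ p q → A′ p r → A′ q r → A′ p t → t ≢ q → t ≢ r → Open″ t q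
          alive⇒threat al pr qr pt t≢q t≢r with proj₁ (proj₂ al) pt t≢q
          ... | inj₂ o = o
          ... | inj₁ tq = ⊥-elim (diamondFree′ (proj₁ al) pr qr pt (A′-sym tq) (≢-sym t≢r))

          obligations : (Alive″ u w → ¬ Full A′ u × ¬ Full A′ w) → (Alive″ u v → ¬ Full A′ u × ¬ Full A′ v) →
                        Obligations
          obligations thin-uw thin-uv = record
            { chord-u = λ a b c o → proj₁ (noChord a b c) (weaken o)
            ; chord-v = λ a b c o → proj₂ (noChord a b c) (weaken o)
            ; matching-u = matching-u
            ; matching-v = λ ap aq → trans (at-v ap) (sym (at-v aq))
            ; fullEnd-u = λ al f → ⊥-elim ([ (λ { refl → proj₁ (thin-uv al) f })
                                           , (λ { refl → proj₁ (thin-uw al) f }) ]′ (at-u al))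
            ; fullEnd-v = λ al f → ⊥-elim (proj₂ (thin-uv (toUv al (at-v al))) f)
            ; apex-u = λ uw₁ wv₁ al f → apex-u (sameApex uw₁ wv₁) al f
            ; apex-v = λ uw₁ wv₁ al f → apex-v (sameApex uw₁ wv₁) al
            ; fullApex = fullApex
            }
            where
              dead-vw : ¬ Alive″ v w
              dead-vw al = ¬vw (alive-old al (A-sy wv))
              at-u : ∀ {p} → Alive″ u p → p ≡ v ⊎ p ≡ w
              at-u {p} al with p ≟ v | p ≟ w
              ... | yes e | _ = inj₁ e
              ... | no _ | yes e = inj₂ e
              ... | no p≢v | no p≢w with proj₁ (proj₂ al) new (≢-sym p≢v)
              ... | inj₁ vp = ⊥-elim (diamondFree′ new uw′ (A′-sym wv′) (proj₁ al) vp (≢-sym p≢w))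
              ... | inj₂ o = ⊥-elim (proj₁ (thin-uv (threat⇒alive new uw′ (A′-sym wv′) (proj₁ al) p≢v p≢w (open-sym o)))
                                      (v , w , p , new , uw′ , proj₁ al , ≢-sym w≢v , ≢-sym p≢v , ≢-sym p≢w))
              at-v : ∀ {p} → Alive″ v p → p ≡ u
              at-v {p} al with p ≟ u | p ≟ w
              ... | yes e | _ = e
              ... | no _ | yes refl = ⊥-elim (dead-vw al)
              ... | no p≢u | no p≢w with proj₁ (proj₂ al) vu′ (≢-sym p≢u)
              ... | inj₁ up = ⊥-elim (diamondFree′ new uw′ (A′-sym wv′) up (proj₁ al) (≢-sym p≢w))
              ... | inj₂ o = ⊥-elim (proj₂ (thin-uv (sym″ (threat⇒alive vu′ (A′-sym wv′) uw′ (proj₁ al) p≢u p≢w (open-sym o))))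
                                      (u , w , p , vu′ , A′-sym wv′ , proj₁ al , ≢-sym w≢u , ≢-sym p≢u , ≢-sym p≢w))
              toUv : ∀ {p} → Alive″ v p → p ≡ u → Alive″ u v
              toUv al refl = sym″ al
              -- Then all neighbours of `v` and `w` would lie in the triangle, which makes `vw`
              -- alive.
              notAllThin : ¬ Full A′ v → ¬ Full A′ w → ⊥
              notAllThin ¬fv′ ¬fw′ = dead-vw (A′-sym wv′
                , (λ vs s≢w → inj₁ (subst (λ s → A′ s w)
                     (sym (onlyNeighbour A′ v ¬fv′ vu′ (A′-sym wv′) (≢-sym w≢u) vs s≢w)) uw′))
                , (λ ws s≢v → inj₁ (subst (λ s → A′ s v)
                     (sym (onlyNeighbour A′ w ¬fw′ (A′-sym uw′) wv′ u≢v ws s≢v)) new)))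
              matching-u : ∀ {p q} → Alive″ u p → Alive″ u q → p ≡ q
              matching-u ap aq with at-u ap | at-u aq
              ... | inj₁ refl | inj₁ refl = refl
              ... | inj₂ refl | inj₂ refl = refl
              ... | inj₁ refl | inj₂ refl = ⊥-elim (notAllThin (proj₂ (thin-uv ap)) (proj₂ (thin-uw aq)))
              ... | inj₂ refl | inj₁ refl = ⊥-elim (notAllThin (proj₂ (thin-uv aq)) (proj₂ (thin-uw ap)))
              -- Two common neighbours would form an old 4-cycle with the open chord `uv`.
              sameApex : ∀ {w₁} → A u w₁ → A w₁ v → w₁ ≡ w
              sameApex {w₁} uw₁ wv₁ with w₁ ≟ w
              ... | yes e = e
              ... | no ne = ⊥-elim (chord safe uw wv (A-sy wv₁) (A-sy uw₁) (≢-sym ne) u≢v (uvF , ¬fu , ¬fv))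
              apex-u : ∀ {w₁} → w₁ ≡ w → Alive″ w₁ u → ¬ Full A′ w₁
              apex-u refl al = proj₂ (thin-uw (sym″ al))
              apex-v : ∀ {w₁} → w₁ ≡ w → ¬ Alive″ w₁ v
              apex-v refl al = dead-vw (sym″ al)
              fullApex : ∀ {t} → Alive″ u v → A′ u t ⊎ A′ v t → t ≢ u → t ≢ v → Full A′ t
              fullApex {t} al tn t≢u t≢v = subst (Full A′) (sym (t≡w tn)) full-w
                where
                  t≡w : A′ u t ⊎ A′ v t → t ≡ w
                  t≡w (inj₁ ut) = onlyNeighbour A′ u (proj₁ (thin-uv al)) uw′ new w≢v ut t≢v
                  t≡w (inj₂ vt) = onlyNeighbour A′ v (proj₂ (thin-uv al)) (A′-sym wv′) vu′ w≢u vt t≢u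
                  full-w : Full A′ w
                  full-w with full? A′? w
                  ... | yes f = f
                  ... | no ¬f = ⊥-elim (notAllThin (proj₂ (thin-uv al)) ¬f)

        openNew-uv : Linked A F u v
        openNew-uv = inj₂ (uvF , ¬fu , ¬fv)

        -- As `u` is full, both `uv` and `uw` have to die. If `xv` is open, forbidding it kills
        -- `uv`, while an alive `uw` would need `w` not full, and then `vw` would have been alive
        -- before the move. If `xv` is not open, `uv` is dead anyway and the pair `xw` kills `uw`.
        replyFull : Full A′ u → Reply A′ F u v
        replyFull fu′ with anotherNeighbour A′ u fu′ v w
        ... | x , ux , x≢v , x≢w with open? A′? F? x v
        ... | yes (_ , _ , ¬fv′) = x , v , λ sh ¬xv → After.preserve sh (obligations sh
                (λ al → ⊥-elim (¬vw (alive-vw (proj₂ (proj₂ (alive⇒threat sh al new wv′ ux x≢w x≢v))))))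
                (λ al → ⊥-elim (¬xv (proj₁ (alive⇒threat sh al uw′ (A′-sym wv′) ux x≢v x≢w)))))
          where
            alive-vw : ¬ Full A′ w → Alive A F v w
            alive-vw ¬fw′ = A-sy wv
              , (λ vs s≢w → ⊥-elim (s≢w (onlyNeighbour A′ v ¬fv′ (A′-sym wv′) vu′ w≢u (old vs) (λ { refl → ¬vu vs }))))
              , (λ ws s≢v → subst (λ s → Linked A F s v)
                   (sym (onlyNeighbour A′ w ¬fw′ (A′-sym uw′) wv′ u≢v (old ws) s≢v)) openNew-uv)
        ... | no ¬xv = x , w , λ sh ¬xw → After.preserve sh (obligations sh
                (λ al → ⊥-elim (¬xw (proj₁ (alive⇒threat sh al new wv′ ux x≢w x≢v))))
                (λ al → ⊥-elim (¬xv (weaken sh (alive⇒threat sh al uw′ (A′-sym wv′) ux x≢v x≢w)))))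

        -- The remaining danger is an alive `uv` with `v` full, which the pair joining a third
        -- neighbour of `v` to `u` removes. If `v` is not full, the taken pair `u v` is a dummy.
        replyAtv : ¬ Full A′ u → (∀ {F″} → Shrinks F F″ u v → Alive A′ F″ u w → ¬ Full A′ w) → Reply A′ F u v
        replyAtv ¬fu′ thin-w with full? A′? v
        ... | no ¬fv′ = u , v , λ sh _ → After.preserve sh (obligations sh
                (λ al → ¬fu′ , thin-w sh al) (λ _ → ¬fu′ , ¬fv′))
        ... | yes fv′ with anotherNeighbour A′ v fv′ u w
        ... | y , vy , y≢u , y≢w = y , u , λ sh ¬yu → After.preserve sh (obligations sh
                (λ al → ¬fu′ , thin-w sh al)
                (λ al → ⊥-elim (¬yu (proj₁ (alive⇒threat sh (After.sym″ sh al) (A′-sym wv′) uw′ vy y≢u y≢w)))))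

        replyThin : ¬ Full A′ u → Reply A′ F u v
        replyThin ¬fu′ with full? A′? w
        ... | no ¬fw′ = replyAtv ¬fu′ (λ _ _ → ¬fw′)
        ... | yes fw′ with anotherNeighbour A′ w fw′ u v
        ... | z , wz , z≢u , z≢v with open? A′? F? z u
        ... | no ¬zu = replyAtv ¬fu′ (λ sh al _ → ¬zu (weaken sh
                (alive⇒threat sh (After.sym″ sh al) wv′ new wz z≢u z≢v)))
        ... | yes zu = z , u , λ sh ¬zu → After.preserve sh (obligations sh
                (λ al → ⊥-elim (¬zu (proj₁ (alive⇒threat sh (After.sym″ sh al) wv′ new wz z≢u z≢v))))
                (λ al → ¬fu′ , λ fv′ → thin-v sh al fv′))
          where
            wz₀ : A w z
            wz₀ = oldElse w≢u w≢v wz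
            alive-wu : Alive A F w u
            alive-wu = A-sy uw
              , (λ ws s≢u → [ (λ { refl → inj₂ (openNew (inj₂ (refl , refl))) }) , (λ { refl → inj₂ (open-A zu) }) ]′
                  (threeNeighbours A w (maxDegree3 safe) (A-sy uw) wv wz₀ u≢v (≢-sym z≢u) (≢-sym z≢v) ws s≢u))
              , (λ us s≢w → ⊥-elim (s≢w (onlyNeighbour A′ u ¬fu′ uw′ new w≢v (old us) (λ { refl → ¬uv us }))))
            full-w : Full A w
            full-w = u , v , z , A-sy uw , wv , wz₀ , u≢v , ≢-sym z≢u , ≢-sym z≢v
            -- Blocker's pair is spent on `uw`, so `uv` must be harmless by itself. Before the move
            -- `wu` was alive and `w` full, so by `fullEnd` all neighbours of `v` were full, and
            -- none of them is open to `u`.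
            thin-v : ∀ {F″} (sh : Shrinks F F″ u v) → Alive A′ F″ u v → ¬ Full A′ v
            thin-v sh al fv′ with anotherNeighbour A′ v fv′ u w
            ... | y , vy , y≢u , y≢w =
              proj₁ (proj₂ (After.open-old sh (alive⇒threat sh (After.sym″ sh al) (A′-sym wv′) uw′ vy y≢u y≢w)))
                (proj₂ (fullEnd safe alive-wu full-w wv (≢-sym u≢v)) (oldAtv vy y≢u))

        choose : Reply A′ F u v
        choose with full? A′? u
        ... | yes fu′ = replyFull fu′
        ... | no ¬fu′ = replyThin ¬fu′

  -- The other answers assume that no 4-cycle through `uv` has an open chord, so that case is tested
  -- first. For a common neighbour `w` the matching at `w` lets at most one of `vw` and `uw` be
  -- alive, so after exchanging the ends if necessary `vw` is dead.
  reply : ∀ {A A′ F : Relation n} → (∀ p q → Dec (A p q)) → (∀ p q → Dec (F p q)) → Safe A F → MaxDegree3 A′ →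
          ∀ {u v} → Extends A A′ u v → F u v → ¬ Full A u → ¬ Full A v → Reply A′ F u v
  reply {A} {A′} {F} A? F? safe deg′ {u} {v} ext uvF ¬fu ¬fv = answer
    where
      module R = Respond A? F? safe deg′ ext uvF ¬fu ¬fv
      module R˘ = Respond A? F? safe deg′ (extends-swap ext) (F-sym safe uvF) ¬fv ¬fu
      openSym : ∀ {p q} → Open A′ F p q → Open A′ F q p
      openSym (f , a , b) = F-sym safe f , b , a
      chord? : Dec (∃[ x ] ∃[ y ] (A u x × A x y × A y v × (Open A′ F u y ⊎ Open A′ F x v)))
      chord? = any? λ x → any? λ y → A? u x ×-dec A? x y ×-dec A? y v ×-dec
        (open? R.A′? F? u y ⊎-dec open? R.A′? F? x v)
      sy : ∀ {p q} → A p q → A q p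
      sy = A-sym safe
      module _ (noChord : R.NoChord) where
        noChord˘ : R˘.NoChord
        noChord˘ vx xy yu = (λ o → proj₂ (noChord (sy yu) (sy xy) (sy vx)) (openSym o))
                          , (λ o → proj₁ (noChord (sy yu) (sy xy) (sy vx)) (openSym o))
        withoutApex : R.NoApex → Reply A′ F u v
        withoutApex noApex with full? R.A′? u | full? R.A′? v | any? (A? u) | any? (A? v)
        ... | yes fu′ | _ | _ | _ = R.fullReply noChord noApex fu′
        ... | no _ | yes fv′ | _ | _ = reply-swap (R˘.fullReply noChord˘ (λ vw wu → noApex (sy wu) (sy vw)) fv′)
        ... | no ¬fu′ | no ¬fv′ | yes (_ , ux) | _ = R.thinReply noChord noApex ¬fu′ ¬fv′ ux
        ... | no ¬fu′ | no ¬fv′ | no _ | yes (_ , vy) =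
          reply-swap (R˘.thinReply noChord˘ (λ vw wu → noApex (sy wu) (sy vw)) ¬fv′ ¬fu′ vy)
        ... | no _ | no _ | no ¬u | no ¬v = R.isolatedReply noChord (λ ux → ¬u (_ , ux)) (λ vy → ¬v (_ , vy))
        withoutChord : Reply A′ F u v
        withoutChord with any? (λ w → A? u w ×-dec A? w v)
        ... | no none = withoutApex (λ uw wv → none (_ , uw , wv))
        ... | yes (w , uw , wv) with alive? A? F? v w
        ... | no ¬vw = R.apexReply noChord uw wv ¬vw
        ... | yes vw = reply-swap (R˘.apexReply noChord˘ (sy wv) (sy uw)
                (λ uw′ → R.u≢v (matching safe (alive-sym sy uw′) (alive-sym sy vw))))
      answer : Reply A′ F u v
      answer with chord?
      ... | yes (_ , _ , ux , xy , yv , inj₁ o) = R.chordReply ux xy yv o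
      ... | yes (_ , _ , ux , xy , yv , inj₂ o) = reply-swap (R˘.chordReply (sy yv) (sy xy) (sy ux) (openSym o))
      ... | no none = withoutChord (λ ux xy yv →
              (λ o → none (_ , _ , ux , xy , yv , inj₁ o)) , (λ o → none (_ , _ , ux , xy , yv , inj₂ o)))

-- Counting triangles, and the game itself

unique-⊆⇒length≤ : ∀ {A : Set} {xs ys : List A} → Unique xs → (∀ {x} → x ∈ xs → x ∈ ys) →
                   length xs ≤ length ys
unique-⊆⇒length≤ {xs = xs} {ys} uniq sub = injective⇒≤ {f = pos} pos-injective
  where
    pos : Fin (length xs) → Fin (length ys)
    pos i = index (sub (∈-lookup {xs = xs} i))
    lookup-injective : ∀ {zs : List _} → Unique zs → ∀ i j → lookup zs i ≡ lookup zs j → i ≡ j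
    lookup-injective (_ ∷ _) zero zero _ = refl
    lookup-injective (x∉ ∷ _) zero (suc j) e = ⊥-elim (All.lookup x∉ (∈-lookup j) e)
    lookup-injective (x∉ ∷ _) (suc i) zero e = ⊥-elim (All.lookup x∉ (∈-lookup i) (sym e))
    lookup-injective (_ ∷ u) (suc i) (suc j) e = cong suc (lookup-injective u i j e)
    pos-injective : ∀ {i j} → pos i ≡ pos j → i ≡ j
    pos-injective {i} {j} e = lookup-injective uniq i j
      (trans (lookup-index (sub (∈-lookup {xs = xs} i)))
        (trans (cong (lookup ys) e) (sym (lookup-index (sub (∈-lookup {xs = xs} j))))))

unique⇒length≤n : ∀ {n} {xs : List (Fin n)} → Unique xs → length xs ≤ n
unique⇒length≤n {n} uniq =
  ≤-trans (unique-⊆⇒length≤ uniq (λ _ → ∈-allFin _)) (≤-reflexive (length-tabulate id))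

concatMap-unique : ∀ {A B : Set} (f : A → List B) {xs} → Unique xs → (∀ x → Unique (f x)) →
                   (∀ {x y z} → z ∈ f x → z ∈ f y → x ≡ y) → Unique (concatMap f xs)
concatMap-unique f uniq each sharedVertex = concat⁺ (Allₚ.map⁺ (All.tabulate (λ {x} _ → each x)))
  (AllPairsₚ.map⁺ (AllPairs.map (λ x≢y {_} (zx , zy) → x≢y (sharedVertex zx zy)) uniq))

∈-if : ∀ {A : Set} {b} {x z : A} → z ∈ (if b then [ x ] else []) → T b × z ≡ x
∈-if {b = true} (here e) = _ , e

if-unique : ∀ {A : Set} b {x : A} → Unique (if b then [ x ] else [])
if-unique true = [] ∷ []
if-unique false = []

-- Edge lists as graphs: adjacency, degree, triangles

module _ {n : ℕ} where

  Adj : Graph n → Relation n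
  Adj G p q = (p , q) ∈ G ⊎ (q , p) ∈ G

  _≟ₑ_ : (e f : Edge n) → Dec (e ≡ f)
  _≟ₑ_ = ≡-dec _≟_ _≟_

  open import Data.List.Membership.DecPropositional _≟ₑ_ using (_∈?_)

  adj? : ∀ G p q → Dec (Adj G p q)
  adj? G p q = (p , q) ∈? G ⊎-dec (q , p) ∈? G

  adj⇒Adj : ∀ G {u v} → T (adj G u v) → Adj G u v
  adj⇒Adj G {u} {v} t with find (any⁻ _ G t)
  ... | (a , b) , e∈ , te with to (T-∨ {(a =ᶠ u) ∧ (b =ᶠ v)}) te
  ... | inj₁ h with to (T-∧ {a =ᶠ u}) h
  ... | h₁ , h₂ with toWitness {a? = a ≟ u} h₁ | toWitness {a? = b ≟ v} h₂
  ... | refl | refl = inj₁ e∈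
  adj⇒Adj G {u} {v} t | (a , b) , e∈ , te | inj₂ h with to (T-∧ {a =ᶠ v}) h
  ... | h₁ , h₂ with toWitness {a? = a ≟ v} h₁ | toWitness {a? = b ≟ u} h₂
  ... | refl | refl = inj₂ e∈

  Adj⇒adj : ∀ G {u v} → Adj G u v → T (adj G u v)
  Adj⇒adj G {u} {v} (inj₁ e∈) = any⁺ _ (lose e∈ (from (T-∨ {(u =ᶠ u) ∧ (v =ᶠ v)})
    (inj₁ (from T-∧ (fromWitness {a? = u ≟ u} refl , fromWitness {a? = v ≟ v} refl)))))
  Adj⇒adj G {u} {v} (inj₂ e∈) = any⁺ _ (lose e∈ (from (T-∨ {(v =ᶠ u) ∧ (u =ᶠ v)})
    (inj₂ (from T-∧ (fromWitness {a? = v ≟ v} refl , fromWitness {a? = u ≟ u} refl)))))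

  otherEnd : Fin n → Edge n → Fin n
  otherEnd v (a , b) = if v =ᶠ a then b else a

  neighbours : Graph n → Fin n → List (Fin n)
  neighbours G v = map (otherEnd v) (filterᵇ (incident v) G)

  length-neighbours : ∀ G v → length (neighbours G v) ≡ degree G v
  length-neighbours G v = length-map (otherEnd v) (filterᵇ (incident v) G)

  Adj⇒∈neighbours : ∀ G {v x} → Adj G v x → x ∈ neighbours G v
  Adj⇒∈neighbours G {v} {x} (inj₁ e∈) = subst (_∈ neighbours G v) other
    (∈-map⁺ (otherEnd v) (∈-filter⁺ (T? ∘ incident v) e∈
      (from (T-∨ {v =ᶠ v}) (inj₁ (fromWitness {a? = v ≟ v} refl)))))
    where
      other : otherEnd v (v , x) ≡ x
      other with v ≟ v
      ... | yes _ = refl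
      ... | no ¬e = ⊥-elim (¬e refl)
  Adj⇒∈neighbours G {v} {x} (inj₂ e∈) = subst (_∈ neighbours G v) other
    (∈-map⁺ (otherEnd v) (∈-filter⁺ (T? ∘ incident v) e∈
      (from (T-∨ {v =ᶠ x}) (inj₂ (fromWitness {a? = v ≟ v} refl)))))
    where
      other : otherEnd v (x , v) ≡ x
      other with v ≟ x
      ... | yes e = e
      ... | no _ = refl

  -- Distinct neighbours come from distinct list entries, so `Full` and `MaxDegree3` can be compared
  -- with the numerical degree without ruling out repeated entries.
  length≤degree : ∀ G {v ns} → Unique ns → All (Adj G v) ns → length ns ≤ degree G v
  length≤degree G {v} uniq adjs = ≤-trans
    (unique-⊆⇒length≤ uniq (λ x∈ → Adj⇒∈neighbours G (All.lookup adjs x∈)))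
    (≤-reflexive (length-neighbours G v))

  S4free⇒degree≤3 : ∀ G → T (S4free G) → ∀ v → degree G v ≤ 3
  S4free⇒degree≤3 G s v = ≤ᵇ⇒≤ _ _ (All.lookup (Allₚ.all⁺ _ (allFin n) s) (∈-allFin v))

  degree≤3⇒S4free : ∀ G → (∀ v → degree G v ≤ 3) → T (S4free G)
  degree≤3⇒S4free G d = Allₚ.all⁻ _ (All.tabulate {xs = allFin n} (λ {v} _ → ≤⇒≤ᵇ (d v)))

  S4free⇒maxDegree3 : ∀ G → T (S4free G) → MaxDegree3 (Adj G)
  S4free⇒maxDegree3 G s {v} va vb vc vd ab ac ad bc bd cd = <⇒≱
    (length≤degree G ((ab ∷ ac ∷ ad ∷ []) ∷ (bc ∷ bd ∷ []) ∷ (cd ∷ []) ∷ [] ∷ []) (va ∷ vb ∷ vc ∷ vd ∷ []))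
    (S4free⇒degree≤3 G s v)

  Full⇒3≤degree : ∀ G {v} → Full (Adj G) v → 3 ≤ degree G v
  Full⇒3≤degree G (_ , _ , _ , va , vb , vc , ab , ac , bc) =
    length≤degree G ((ab ∷ ac ∷ []) ∷ (bc ∷ []) ∷ [] ∷ []) (va ∷ vb ∷ vc ∷ [])

  incident-fst : ∀ (a b : Fin n) → T (incident a (a , b))
  incident-fst a b = from (T-∨ {a =ᶠ a} {a =ᶠ b}) (inj₁ (fromWitness {a? = a ≟ a} refl))

  incident-snd : ∀ (a b : Fin n) → T (incident b (a , b))
  incident-snd a b = from (T-∨ {b =ᶠ a} {b =ᶠ b}) (inj₂ (fromWitness {a? = b ≟ b} refl))

  degree-incident : ∀ (e : Edge n) (G : Graph n) v → T (incident v e) → degree (e ∷ G) v ≡ suc (degree G v)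
  degree-incident e G v t with incident v e
  ... | true = refl

  degree-¬incident : ∀ (e : Edge n) (G : Graph n) v → ¬ T (incident v e) → degree (e ∷ G) v ≡ degree G v
  degree-¬incident e G v ¬t with incident v e
  ... | true = ⊥-elim (¬t _)
  ... | false = refl

  S4free⇒¬Full : ∀ G {e v} → T (S4free (e ∷ G)) → T (incident v e) → ¬ Full (Adj G) v
  S4free⇒¬Full G {e} {v} s inc full = <⇒≱ (s≤s (Full⇒3≤degree G full))
    (subst (_≤ 3) (degree-incident e G v inc) (S4free⇒degree≤3 (e ∷ G) s v))

  Adj-extends : ∀ G u v → Extends (Adj G) (Adj ((u , v) ∷ G)) u v
  Adj-extends G u v = record
    { old = [ inj₁ ∘ there , inj₂ ∘ there ]′
    ; new = inj₁ (here refl)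
    ; only = λ { (inj₁ (here refl)) → inj₂ (inj₁ (refl , refl)) ; (inj₁ (there x)) → inj₁ (inj₁ x)
               ; (inj₂ (here refl)) → inj₂ (inj₂ (refl , refl)) ; (inj₂ (there x)) → inj₁ (inj₂ x) }
    ; A′-sym = swap
    }

  Triangle : Graph n → Fin n → Fin n → Fin n → Set
  Triangle G i j k = Adj G i j × Adj G j k × Adj G i k

  isTriangle : Graph n → Fin n → Fin n → Fin n → Bool
  isTriangle G i j k = (toℕ i <ᵇ toℕ j) ∧ (toℕ j <ᵇ toℕ k) ∧ adj G i j ∧ adj G j k ∧ adj G i k

  isTriangle⁻ : ∀ G {i j k} → T (isTriangle G i j k) → toℕ i < toℕ j × toℕ j < toℕ k × Triangle G i j k
  isTriangle⁻ G {i} {j} {k} t =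
    let t₁ , r₁ = to (T-∧ {toℕ i <ᵇ toℕ j}) t
        t₂ , r₂ = to (T-∧ {toℕ j <ᵇ toℕ k}) r₁
        t₃ , r₃ = to (T-∧ {adj G i j}) r₂
        t₄ , t₅ = to (T-∧ {adj G j k}) r₃
    in <ᵇ⇒< _ _ t₁ , <ᵇ⇒< _ _ t₂ , adj⇒Adj G t₃ , adj⇒Adj G t₄ , adj⇒Adj G t₅

  isTriangle⁺ : ∀ G {i j k} → toℕ i < toℕ j → toℕ j < toℕ k → Triangle G i j k → T (isTriangle G i j k)
  isTriangle⁺ G i<j j<k (ij , jk , ik) = from T-∧ (<⇒<ᵇ i<j , from T-∧ (<⇒<ᵇ j<k ,
    from T-∧ (Adj⇒adj G ij , from T-∧ (Adj⇒adj G jk , Adj⇒adj G ik))))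

  module _ (G : Graph n) where

    trianglesAt₂ : Fin n → Fin n → Fin n → List (Fin n × Fin n × Fin n)
    trianglesAt₂ i j k = if isTriangle G i j k then [ (i , j , k) ] else []

    trianglesAt₁ : Fin n → Fin n → List (Fin n × Fin n × Fin n)
    trianglesAt₁ i j = concatMap (trianglesAt₂ i j) (allFin n)

    trianglesAt : Fin n → List (Fin n × Fin n × Fin n)
    trianglesAt i = concatMap (trianglesAt₁ i) (allFin n)

    triangleList : List (Fin n × Fin n × Fin n)
    triangleList = concatMap trianglesAt (allFin n)

    IsTriangleAt : Fin n × Fin n × Fin n → Set
    IsTriangleAt (i , j , k) = toℕ i < toℕ j × toℕ j < toℕ k × Triangle G i j k

    ∈-trianglesAt₂ : ∀ {i j k t} → t ∈ trianglesAt₂ i j k → IsTriangleAt t × t ≡ (i , j , k)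
    ∈-trianglesAt₂ {i} {j} {k} t∈ with ∈-if {b = isTriangle G i j k} t∈
    ... | b , refl = isTriangle⁻ G b , refl

    ∈-trianglesAt₁ : ∀ {i j t} → t ∈ trianglesAt₁ i j → IsTriangleAt t × ∃[ k ] (t ≡ (i , j , k))
    ∈-trianglesAt₁ t∈ with find (∈-concatMap⁻ _ {xs = allFin n} t∈)
    ... | k , _ , t∈′ = map₂ (k ,_) (∈-trianglesAt₂ t∈′)

    ∈-trianglesAt : ∀ {i t} → t ∈ trianglesAt i → IsTriangleAt t × ∃[ j ] ∃[ k ] (t ≡ (i , j , k))
    ∈-trianglesAt t∈ with find (∈-concatMap⁻ _ {xs = allFin n} t∈)
    ... | j , _ , t∈′ = map₂ (j ,_) (∈-trianglesAt₁ t∈′)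

    ∈-triangleList : ∀ {t} → t ∈ triangleList → IsTriangleAt t
    ∈-triangleList t∈ with find (∈-concatMap⁻ _ {xs = allFin n} t∈)
    ... | _ , _ , t∈′ = proj₁ (∈-trianglesAt t∈′)

    triangleList-unique : Unique triangleList
    triangleList-unique = concatMap-unique trianglesAt (allFin⁺ n)
      (λ i → concatMap-unique (trianglesAt₁ i) (allFin⁺ n)
        (λ j → concatMap-unique (trianglesAt₂ i j) (allFin⁺ n) (λ k → if-unique (isTriangle G i j k)) third)
        second)
      first
      where
        third : ∀ {i j x y t} → t ∈ trianglesAt₂ i j x → t ∈ trianglesAt₂ i j y → x ≡ y
        third tx ty with proj₂ (∈-trianglesAt₂ tx) | proj₂ (∈-trianglesAt₂ ty)
        ... | refl | refl = refl
        second : ∀ {i x y t} → t ∈ trianglesAt₁ i x → t ∈ trianglesAt₁ i y → x ≡ y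
        second tx ty with proj₂ (∈-trianglesAt₁ tx) | proj₂ (∈-trianglesAt₁ ty)
        ... | _ , refl | _ , refl = refl
        first : ∀ {x y t} → t ∈ trianglesAt x → t ∈ trianglesAt y → x ≡ y
        first tx ty with proj₂ (∈-trianglesAt tx) | proj₂ (∈-trianglesAt ty)
        ... | _ , _ , refl | _ , _ , refl = refl

    module _ (deg : MaxDegree3 (Adj G)) (free : DiamondFree (Adj G)) where

      -- Two triangles at `v` with exactly one further common vertex form a diamond; with none they
      -- give `v` four neighbours.
      sameTriangle : ∀ {v a b c d} → a ≢ b → c ≢ d → Adj G v a → Adj G v b → Adj G a b →
                     Adj G v c → Adj G v d → Adj G c d → (a ≡ c × b ≡ d) ⊎ (a ≡ d × b ≡ c)
      sameTriangle {v} {a} {b} {c} {d} a≢b c≢d va vb ab vc vd cd with a ≟ c | b ≟ d | a ≟ d | b ≟ c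
      ... | yes p    | yes q    | _        | _        = inj₁ (p , q)
      ... | _        | _        | yes p    | yes q    = inj₂ (p , q)
      ... | yes refl | no b≢d   | _        | _        = ⊥-elim (free va vb ab vd cd b≢d)
      ... | no a≢c   | yes refl | _        | _        = ⊥-elim (free vb va (swap ab) vc (swap cd) a≢c)
      ... | no _     | no _     | yes refl | no b≢c   = ⊥-elim (free va vb ab vc (swap cd) b≢c)
      ... | no _     | no _     | no a≢d   | yes refl = ⊥-elim (free vb va (swap ab) vd cd a≢d)
      ... | no a≢c   | no b≢d   | no a≢d   | no b≢c   = ⊥-elim (deg va vb vc vd a≢b a≢c a≢d b≢c b≢d c≢d)

      vertices : Fin n × Fin n × Fin n → List (Fin n)
      vertices (i , j , k) = i ∷ j ∷ k ∷ []

      private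
        <⇒≢ᶠ : ∀ {i j : Fin n} → toℕ i < toℕ j → i ≢ j
        <⇒≢ᶠ i<j refl = <-irrefl refl i<j

        cycle₂ : ∀ {a b : ℕ} {C : Set} → a < b → b < a → C
        cycle₂ p q = ⊥-elim (<-asym p q)

        cycle₃ : ∀ {a b c : ℕ} {C : Set} → a < b → b < c → c < a → C
        cycle₃ p q r = cycle₂ (<-trans p q) r

      -- Each of the nine positions of the common vertex reduces to `sameTriangle`; a matching of
      -- the other vertices that does not respect the increasing order is cyclic and impossible.
      sharedVertex : ∀ {s t} → IsTriangleAt s → IsTriangleAt t → ∀ {v} → v ∈ vertices s → v ∈ vertices t → s ≡ t
      sharedVertex (p , q , ij , jk , ik) (p′ , q′ , ij′ , jk′ , ik′) = go
        where
          ij≢ = <⇒≢ᶠ p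
          jk≢ = <⇒≢ᶠ q
          ik≢ = <⇒≢ᶠ (<-trans p q)
          ij≢′ = <⇒≢ᶠ p′
          jk≢′ = <⇒≢ᶠ q′
          ik≢′ = <⇒≢ᶠ (<-trans p′ q′)
          go : ∀ {v} → v ∈ vertices _ → v ∈ vertices _ → _ ≡ _
          go (here refl) (here refl) with sameTriangle jk≢ jk≢′ ij ik jk ij′ ik′ jk′
          ... | inj₁ (refl , refl) = refl
          ... | inj₂ (refl , refl) = cycle₂ q q′
          go (here refl) (there (here refl)) with sameTriangle jk≢ ik≢′ ij ik jk (swap ij′) jk′ ik′
          ... | inj₁ (refl , refl) = cycle₂ p p′
          ... | inj₂ (refl , refl) = cycle₃ p q p′
          go (here refl) (there (there (here refl))) with sameTriangle jk≢ ij≢′ ij ik jk (swap ik′) (swap jk′) ij′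
          ... | inj₁ (refl , refl) = cycle₃ p p′ q′
          ... | inj₂ (refl , refl) = cycle₂ p q′
          go (there (here refl)) (here refl) with sameTriangle ik≢ jk≢′ (swap ij) jk ik ij′ ik′ jk′
          ... | inj₁ (refl , refl) = cycle₂ p p′
          ... | inj₂ (refl , refl) = cycle₃ p p′ q′
          go (there (here refl)) (there (here refl)) with sameTriangle ik≢ ik≢′ (swap ij) jk ik (swap ij′) jk′ ik′
          ... | inj₁ (refl , refl) = refl
          ... | inj₂ (refl , refl) = cycle₂ p q′
          go (there (here refl)) (there (there (here refl))) with sameTriangle ik≢ ij≢′ (swap ij) jk ik (swap ik′) (swap jk′) ij′
          ... | inj₁ (refl , refl) = cycle₂ q q′
          ... | inj₂ (refl , refl) = cycle₃ q p′ q′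
          go (there (there (here refl))) (here refl) with sameTriangle ij≢ jk≢′ (swap ik) (swap jk) ij ij′ ik′ jk′
          ... | inj₁ (refl , refl) = cycle₃ p q p′
          ... | inj₂ (refl , refl) = cycle₂ q p′
          go (there (there (here refl))) (there (here refl)) with sameTriangle ij≢ ik≢′ (swap ik) (swap jk) ij (swap ij′) jk′ ik′
          ... | inj₁ (refl , refl) = cycle₂ q q′
          ... | inj₂ (refl , refl) = cycle₃ p q q′
          go (there (there (here refl))) (there (there (here refl))) with sameTriangle ij≢ ij≢′ (swap ik) (swap jk) ij (swap ik′) (swap jk′) ij′
          ... | inj₁ (refl , refl) = refl
          ... | inj₂ (refl , refl) = cycle₂ p p′

      length-flatten : ∀ ts → length (concatMap vertices ts) ≡ 3 * length ts
      length-flatten [] = refl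
      length-flatten (t ∷ ts) = trans (cong (3 +_) (length-flatten ts)) (sym (*-suc 3 (length ts)))

      flatten-unique : ∀ {ts} → Unique ts → All IsTriangleAt ts → Unique (concatMap vertices ts)
      flatten-unique {ts} uniq tri = concat⁺ (Allₚ.map⁺ (All.map each tri)) (AllPairsₚ.map⁺ (pairs uniq tri))
        where
          each : ∀ {t} → IsTriangleAt t → Unique (vertices t)
          each (p , q , _) = (<⇒≢ᶠ p ∷ <⇒≢ᶠ (<-trans p q) ∷ []) ∷ (<⇒≢ᶠ q ∷ []) ∷ [] ∷ []
          pairs : ∀ {ts} → Unique ts → All IsTriangleAt ts →
                  AllPairs (λ s t → Disjoint (vertices s) (vertices t)) ts
          pairs [] [] = []
          pairs (x∉ ∷ u) (t ∷ ts) = All.zipWith (λ (x≢ , s) {_} (vx , vy) → x≢ (sharedVertex t s vx vy)) (x∉ , ts) ∷ pairs u ts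

      3*triangles≤n : 3 * triangles G ≤ n
      3*triangles≤n = subst (_≤ n) (length-flatten triangleList)
        (unique⇒length≤n (flatten-unique triangleList-unique (All.tabulate ∈-triangleList)))

  -- Unclaimed edges, and the invariant as a bound on `value`

  Unclaimed : ∀ {k} → Vec (Edge n) k → Edge n → Set
  Unclaimed free e = ∃[ i ] (Vec.lookup free i ≡ e)

  Distinct : ∀ {k} → Vec (Edge n) k → Set
  Distinct free = ∀ {i j} → Vec.lookup free i ≡ Vec.lookup free j → i ≡ j

  Sorted : ∀ {k} → Vec (Edge n) k → Set
  Sorted free = ∀ i → toℕ (proj₁ (Vec.lookup free i)) < toℕ (proj₂ (Vec.lookup free i))

lookup-removeAt : ∀ {A : Set} {k} (xs : Vec A (suc k)) i j →
                  Vec.lookup (removeAt xs i) j ≡ Vec.lookup xs (punchIn i j)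
lookup-removeAt (x ∷ xs) zero j = refl
lookup-removeAt (x ∷ y ∷ xs) (suc i) zero = refl
lookup-removeAt (x ∷ y ∷ xs) (suc i) (suc j) = lookup-removeAt (y ∷ xs) i j

maxList-≤ : ∀ {A : Set} (f : A → ℕ) {t} xs → (∀ {x} → x ∈ xs → f x ≤ t) → maxList (map f xs) ≤ t
maxList-≤ f [] h = z≤n
maxList-≤ f (x ∷ xs) h = ⊔-lub (h (here refl)) (maxList-≤ f xs (h ∘ there))

≤-maxList : ∀ {A : Set} (f : A → ℕ) {x xs} → x ∈ xs → f x ≤ maxList (map f xs)
≤-maxList f (here refl) = m≤m⊔n _ _
≤-maxList f (there x∈) = ≤-trans (≤-maxList f x∈) (m≤n⊔m _ _)

foldr₁-⊓-≤ : ∀ {k} (f : Fin (suc k) → ℕ) i → foldr₁ _⊓_ (tabulate f) ≤ f i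
foldr₁-⊓-≤ {zero} f zero = ≤-refl
foldr₁-⊓-≤ {suc k} f zero = m⊓n≤m _ _
foldr₁-⊓-≤ {suc k} f (suc i) = ≤-trans (m⊓n≤n (f zero) _) (foldr₁-⊓-≤ (f ∘ suc) i)

≤-foldr₁-⊓ : ∀ {k t} (f : Fin (suc k) → ℕ) → (∀ i → t ≤ f i) → t ≤ foldr₁ _⊓_ (tabulate f)
≤-foldr₁-⊓ {zero} f h = h zero
≤-foldr₁-⊓ {suc k} f h = ⊓-glb (h zero) (≤-foldr₁-⊓ (f ∘ suc) (h ∘ suc))

module _ {n : ℕ} where

  module _ {k} (free : Vec (Edge n) (suc k)) (i : Fin (suc k)) where

    removeAt-unclaimed⁻ : ∀ {e} → Unclaimed (removeAt free i) e → Unclaimed free e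
    removeAt-unclaimed⁻ (j , eq) = punchIn i j , trans (sym (lookup-removeAt free i j)) eq

    removeAt-unclaimed⁺ : ∀ {e} → Unclaimed free e → e ≢ Vec.lookup free i → Unclaimed (removeAt free i) e
    removeAt-unclaimed⁺ (j , refl) e≢ = punchOut i≢j , removeAt-punchOut free i≢j
      where i≢j : i ≢ j
            i≢j refl = e≢ refl

    removeAt-distinct : Distinct free → Distinct (removeAt free i)
    removeAt-distinct dist {j} {l} e = punchIn-injective i j l
      (dist (trans (sym (lookup-removeAt free i j)) (trans e (lookup-removeAt free i l))))

    removeAt-gone : Distinct free → ¬ Unclaimed (removeAt free i) (Vec.lookup free i)
    removeAt-gone dist (j , e) = punchInᵢ≢i i j (dist (trans (sym (lookup-removeAt free i j)) e))

    removeAt-sorted : Sorted free → Sorted (removeAt free i)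
    removeAt-sorted sorted j rewrite lookup-removeAt free i j = sorted (punchIn i j)

  Free : ∀ {k} → Vec (Edge n) k → Relation n
  Free free p q = Unclaimed free (p , q) ⊎ Unclaimed free (q , p)

  free? : ∀ {k} (free : Vec (Edge n) k) p q → Dec (Free free p q)
  free? free p q = any? (λ i → Vec.lookup free i ≟ₑ (p , q)) ⊎-dec any? (λ i → Vec.lookup free i ≟ₑ (q , p))

  sorted-antisym : ∀ {k} {free : Vec (Edge n) k} → Sorted free → ∀ {p q} →
                   Unclaimed free (p , q) → ¬ Unclaimed free (q , p)
  sorted-antisym sorted (i , refl) (j , e) with sorted j
  ... | lt rewrite e = <-asym (sorted i) lt

  -- `Distinct` excludes a second copy of the pair, and `Sorted` its reversal.
  removeAt-gone₂ : ∀ {k} (free : Vec (Edge n) (suc k)) i → Distinct free → Sorted free → ∀ {p q} →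
                   Vec.lookup free i ≡ (p , q) → ¬ Free (removeAt free i) p q
  removeAt-gone₂ free i dist sorted e (inj₁ f) =
    removeAt-gone free i dist (subst (Unclaimed (removeAt free i)) (sym e) f)
  removeAt-gone₂ free i dist sorted e (inj₂ f) =
    sorted-antisym {free = free} sorted (i , e) (removeAt-unclaimed⁻ free i f)

  module _ {k} (C : Graph n) (free : Vec (Edge n) (suc k)) where

    private
      legal : Fin (suc k) → Bool
      legal i = S4free (Vec.lookup free i ∷ C)

      after : Fin (suc k) → ℕ
      after i = value k false (Vec.lookup free i ∷ C) (removeAt free i)

    value-true-≤ : ∀ {t} → triangles C ≤ t → (∀ i → T (legal i) → after i ≤ t) → value (suc k) true C free ≤ t
    value-true-≤ stop move with filterᵇ legal (allFin (suc k)) in eq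
    ... | [] = stop
    ... | m ∷ ms = maxList-≤ after (m ∷ ms) (λ {i} i∈ →
            move i (proj₂ (∈-filter⁻ (T? ∘ legal) {xs = allFin (suc k)} (subst (i ∈_) (sym eq) i∈))))

    ≤-value-true : ∀ i → T (legal i) → after i ≤ value (suc k) true C free
    ≤-value-true i ok with filterᵇ legal (allFin (suc k)) in eq
    ... | [] with () ← subst (i ∈_) eq (∈-filter⁺ (T? ∘ legal) (∈-allFin i) ok)
    ... | m ∷ ms = ≤-maxList after (subst (i ∈_) eq (∈-filter⁺ (T? ∘ legal) (∈-allFin i) ok))

  mutual
    constructor-≤ : ∀ k C (free : Vec (Edge n) k) → Distinct free → Sorted free →
                    Safe (Adj C) (Free free) → value k true C free ≤ n / 3
    constructor-≤ zero C free dist sorted safe = triangles-≤ C safe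
    constructor-≤ (suc k) C free dist sorted safe = value-true-≤ C free (triangles-≤ C safe) (λ i legal →
      let (a , b) = Vec.lookup free i
          (x , y , react) = reply (adj? C) (free? free) safe (S4free⇒maxDegree3 ((a , b) ∷ C) legal)
                                  (Adj-extends C a b) (inj₁ (i , refl))
                                  (S4free⇒¬Full C legal (incident-fst a b)) (S4free⇒¬Full C legal (incident-snd a b))
      in blocker-≤ k ((a , b) ∷ C) (removeAt free i) (removeAt-distinct free i dist) (removeAt-sorted free i sorted)
           (x , y , λ sub F-sym ¬xy → react (record
             { sub = λ f → [ inj₁ ∘ removeAt-unclaimed⁻ free i , inj₂ ∘ removeAt-unclaimed⁻ free i ]′ (sub f)
             ; F″-sym = F-sym
             ; taken = λ f → removeAt-gone₂ free i dist sorted refl (sub f) }) ¬xy))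

    blocker-≤ : ∀ k C (free : Vec (Edge n) k) → Distinct free → Sorted free →
                ∃[ x ] ∃[ y ] (∀ {F : Relation n} → (∀ {p q} → F p q → Free free p q) →
                  (∀ {p q} → F p q → F q p) → ¬ F x y → Safe (Adj C) F) →
                value k false C free ≤ n / 3
    blocker-≤ zero C free dist sorted (x , y , safe) =
      triangles-≤ C (safe {F = λ _ _ → ⊥} (λ ()) (λ ()) (λ ()))
    blocker-≤ (suc k) C free dist sorted (x , y , safe) = block (free? free x y)
      where
        claim : ∀ i → ¬ Free (removeAt free i) x y → value (suc k) false C free ≤ n / 3
        claim i ¬xy = ≤-trans (foldr₁-⊓-≤ (λ i → value k true C (removeAt free i)) i)
          (constructor-≤ k C (removeAt free i) (removeAt-distinct free i dist) (removeAt-sorted free i sorted)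
            (safe [ inj₁ ∘ removeAt-unclaimed⁻ free i , inj₂ ∘ removeAt-unclaimed⁻ free i ]′ swap ¬xy))
        block : Dec (Free free x y) → value (suc k) false C free ≤ n / 3
        block (yes (inj₁ (i , e))) = claim i (removeAt-gone₂ free i dist sorted e)
        block (yes (inj₂ (i , e))) = claim i (removeAt-gone₂ free i dist sorted e ∘ swap)
        -- The pair is gone already, so every edge is as good as any other.
        block (no ¬xy) = claim zero (λ f → ¬xy
          ([ inj₁ ∘ removeAt-unclaimed⁻ free zero , inj₂ ∘ removeAt-unclaimed⁻ free zero ]′ f))

    triangles-≤ : ∀ C {F : Relation n} → Safe (Adj C) F → triangles C ≤ n / 3
    triangles-≤ C safe = subst (_≤ n / 3) (m*n/n≡m (triangles C) 3)
      (/-monoˡ-≤ 3 (subst (_≤ n) (*-comm 3 (triangles C))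
        (3*triangles≤n C (Safe.maxDegree3 safe) (Safe.diamondFree safe))))

  ∈-edgesK⁻ : ∀ {a b : Fin n} → (a , b) ∈ edgesK n → toℕ a < toℕ b
  ∈-edgesK⁻ e∈ with find (∈-concatMap⁻ _ {xs = allFin n} e∈)
  ... | i , _ , e∈ᵢ with find (∈-concatMap⁻ _ {xs = allFin n} e∈ᵢ)
  ... | j , _ , e∈ⱼ with ∈-if {b = toℕ i <ᵇ toℕ j} e∈ⱼ
  ... | i<j , refl = <ᵇ⇒< _ _ i<j

  ∈-edgesK⁺ : ∀ {a b : Fin n} → toℕ a < toℕ b → (a , b) ∈ edgesK n
  ∈-edgesK⁺ {a} {b} a<b = ∈-concatMap⁺ _ (lose (∈-allFin a) (∈-concatMap⁺ _ (lose (∈-allFin b) here!)))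
    where
      here! : (a , b) ∈ (if toℕ a <ᵇ toℕ b then [ (a , b) ] else [])
      here! with toℕ a <ᵇ toℕ b | <⇒<ᵇ a<b
      ... | true | _ = here refl

  edgesK-unique : Unique (edgesK n)
  edgesK-unique = concatMap-unique _ (allFin⁺ n)
    (λ i → concatMap-unique _ (allFin⁺ n) (λ j → if-unique (toℕ i <ᵇ toℕ j)) second) first
    where
      row : Fin n → Fin n → List (Edge n)
      row i j = if toℕ i <ᵇ toℕ j then [ (i , j) ] else []
      second : ∀ {i x y e} → e ∈ row i x → e ∈ row i y → x ≡ y
      second {i} {x} {y} ex ey with ∈-if {b = toℕ i <ᵇ toℕ x} ex | ∈-if {b = toℕ i <ᵇ toℕ y} ey
      ... | _ , refl | _ , refl = refl
      fst-row : ∀ {i e} → e ∈ concatMap (row i) (allFin n) → proj₁ e ≡ i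
      fst-row {i} e∈ with find (∈-concatMap⁻ (row i) {xs = allFin n} e∈)
      ... | j , _ , e∈ⱼ with ∈-if {b = toℕ i <ᵇ toℕ j} e∈ⱼ
      ... | _ , refl = refl
      first : ∀ {x y e} → e ∈ concatMap (row x) (allFin n) → e ∈ concatMap (row y) (allFin n) → x ≡ y
      first ex ey = trans (sym (fst-row ex)) (fst-row ey)

lookup-fromList-∈ : ∀ {A : Set} (xs : List A) i → Vec.lookup (Vec.fromList xs) i ∈ xs
lookup-fromList-∈ (x ∷ xs) zero = here refl
lookup-fromList-∈ (x ∷ xs) (suc i) = there (lookup-fromList-∈ xs i)

fromList-distinct : ∀ {A : Set} {xs : List A} → Unique xs → ∀ {i j} →
                    Vec.lookup (Vec.fromList xs) i ≡ Vec.lookup (Vec.fromList xs) j → i ≡ j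
fromList-distinct (_ ∷ _) {zero} {zero} e = refl
fromList-distinct (x∉ ∷ _) {zero} {suc j} e = ⊥-elim (All.lookup x∉ (lookup-fromList-∈ _ j) e)
fromList-distinct (x∉ ∷ _) {suc i} {zero} e = ⊥-elim (All.lookup x∉ (lookup-fromList-∈ _ i) (sym e))
fromList-distinct (_ ∷ u) {suc i} {suc j} e = cong suc (fromList-distinct u e)

-- The start of the game and the upper bound

module _ (n : ℕ) where

  start : Vec (Edge n) (length (edgesK n))
  start = Vec.fromList (edgesK n)

  start-distinct : Distinct start
  start-distinct = fromList-distinct edgesK-unique

  start-sorted : Sorted start
  start-sorted i = ∈-edgesK⁻ (lookup-fromList-∈ (edgesK n) i)

  start-safe : Safe (Adj []) (Free start)
  start-safe = record
    { A-sym = swap ; A-irrefl = λ { (inj₁ ()) ; (inj₂ ()) } ; F-sym = swap ; F-irrefl = irrefl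
    ; disjoint = λ { _ (inj₁ ()) ; _ (inj₂ ()) } ; maxDegree3 = λ { (inj₁ ()) ; (inj₂ ()) }
    ; diamondFree = λ { (inj₁ ()) ; (inj₂ ()) } ; matching = λ { (inj₁ () , _) ; (inj₂ () , _) }
    ; fullEnd = λ { (inj₁ () , _) ; (inj₂ () , _) } ; chord = λ { (inj₁ ()) ; (inj₂ ()) }
    ; farApart = λ { (inj₁ () , _) ; (inj₂ () , _) } }
    where
      irrefl : ∀ {p} → ¬ Free start p p
      irrefl (inj₁ u) = sorted-antisym {free = start} start-sorted u u
      irrefl (inj₂ u) = sorted-antisym {free = start} start-sorted u u

  3*g≤n : 3 * g n ≤ n
  3*g≤n = ≤-trans (*-monoʳ-≤ 3 (constructor-≤ (length (edgesK n)) [] start start-distinct start-sorted start-safe))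
            (subst (_≤ n) (*-comm (n / 3) 3) (m/n*n≤m n 3))

-- Constructor's strategy

module _ {A B : Set} {f g : A → List B} (f≤g : ∀ x → length (f x) ≤ length (g x)) where

  length-concatMap-mono : ∀ xs → length (concatMap f xs) ≤ length (concatMap g xs)
  length-concatMap-mono [] = z≤n
  length-concatMap-mono (x ∷ xs)
    rewrite length-++ (f x) {concatMap f xs} | length-++ (g x) {concatMap g xs} =
    +-mono-≤ (f≤g x) (length-concatMap-mono xs)

  length-concatMap-strict : ∀ {x xs} → x ∈ xs → length (f x) < length (g x) →
                            length (concatMap f xs) < length (concatMap g xs)
  length-concatMap-strict {x} {_ ∷ xs} (here refl) lt
    rewrite length-++ (f x) {concatMap f xs} | length-++ (g x) {concatMap g xs} =
    +-mono-<-≤ lt (length-concatMap-mono xs)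
  length-concatMap-strict {x} {y ∷ xs} (there x∈) lt
    rewrite length-++ (f y) {concatMap f xs} | length-++ (g y) {concatMap g xs} =
    +-mono-≤-< (f≤g y) (length-concatMap-strict x∈ lt)

length-if-mono : ∀ {A : Set} {b c} {x : A} → (T b → T c) →
                 length (if b then [ x ] else []) ≤ length (if c then [ x ] else [])
length-if-mono {b = false} h = z≤n
length-if-mono {b = true} {true} h = ≤-refl
length-if-mono {b = true} {false} h = ⊥-elim (h _)

length-if-strict : ∀ {A : Set} {b c} {x : A} → ¬ T b → T c →
                   length (if b then [ x ] else []) < length (if c then [ x ] else [])
length-if-strict {b = false} {true} h t = ≤-refl
length-if-strict {b = true} h t = ⊥-elim (h _)

-- A minimum is attained, so whatever holds after every answer of Blocker holds for the minimum,
-- even for a property that is not monotone.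
foldr₁-⊓-∈ : ∀ {k} (P : ℕ → Set) (f : Fin (suc k) → ℕ) → (∀ i → P (f i)) → P (foldr₁ _⊓_ (tabulate f))
foldr₁-⊓-∈ {zero} P f h = h zero
foldr₁-⊓-∈ {suc k} P f h with ⊓-sel (f zero) (foldr₁ _⊓_ (tabulate (f ∘ suc)))
... | inj₁ e = subst P (sym e) (h zero)
... | inj₂ e = subst P (sym e) (foldr₁-⊓-∈ P (f ∘ suc) (h ∘ suc))

pick : ∀ {n} {xs : List (Fin n)} → Unique xs → ∀ ys → length ys < length xs → ∃[ x ] (x ∈ xs × x ∉ ys)
pick {n} {xs} uniq ys lt with Any.any? (λ x → ¬? (x ∈? ys)) xs
  where open import Data.List.Membership.DecPropositional (_≟_ {n}) using (_∈?_)
... | yes found = find found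
... | no none = ⊥-elim (<⇒≱ lt (unique-⊆⇒length≤ uniq (λ {x} x∈ →
        decidable-stable (x ∈? ys) (All.lookup (Allₚ.¬Any⇒All¬ xs none) x∈))))
  where open import Data.List.Membership.DecPropositional (_≟_ {n}) using (_∈?_)

-- Triangle counts of growing graphs

module _ {n : ℕ} where

  remove : Fin n → List (Fin n) → List (Fin n)
  remove v = filter (λ w → ¬? (w ≟ v))

  ∈-remove⁻ : ∀ {v w xs} → w ∈ remove v xs → w ∈ xs × w ≢ v
  ∈-remove⁻ {v} = ∈-filter⁻ (λ w → ¬? (w ≟ v))

  remove-unique : ∀ {v xs} → Unique xs → Unique (remove v xs)
  remove-unique {v} = filter⁺ (λ w → ¬? (w ≟ v))

  length-remove : ∀ {v xs} → Unique xs → v ∈ xs → suc (length (remove v xs)) ≡ length xs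
  length-remove {v} {xs} uniq v∈ = ≤-antisym
    (unique-⊆⇒length≤ (All.tabulate (λ w∈ → ≢-sym (proj₂ (∈-remove⁻ {xs = xs} w∈))) ∷ remove-unique uniq)
      (λ { (here refl) → v∈ ; (there w∈) → proj₁ (∈-remove⁻ {xs = xs} w∈) }))
    (unique-⊆⇒length≤ uniq back)
    where
      back : ∀ {w} → w ∈ xs → w ∈ v ∷ remove v xs
      back {w} w∈ with w ≟ v
      ... | yes refl = here refl
      ... | no w≢v = there (∈-filter⁺ (λ w → ¬? (w ≟ v)) w∈ w≢v)

  module _ {G G′ : Graph n} (G⊆G′ : ∀ {p q} → Adj G p q → Adj G′ p q) where

    private
      grow : ∀ {i j k} → T (isTriangle G i j k) → T (isTriangle G′ i j k)
      grow {i} {j} {k} t = let (i<j , j<k , ij , jk , ik) = isTriangle⁻ G {i} {j} {k} t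
               in isTriangle⁺ G′ {i} {j} {k} i<j j<k (G⊆G′ ij , G⊆G′ jk , G⊆G′ ik)

      mono₂ : ∀ i j k → length (trianglesAt₂ G i j k) ≤ length (trianglesAt₂ G′ i j k)
      mono₂ i j k = length-if-mono (grow {i} {j} {k})

      mono₁ : ∀ i j → length (trianglesAt₁ G i j) ≤ length (trianglesAt₁ G′ i j)
      mono₁ i j = length-concatMap-mono (mono₂ i j) (allFin n)

      mono₀ : ∀ i → length (trianglesAt G i) ≤ length (trianglesAt G′ i)
      mono₀ i = length-concatMap-mono (mono₁ i) (allFin n)

    triangles-mono : triangles G ≤ triangles G′
    triangles-mono = length-concatMap-mono mono₀ (allFin n)

    triangles-strict : ∀ {i j k} → toℕ i < toℕ j → toℕ j < toℕ k → Triangle G′ i j k → ¬ Triangle G i j k →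
                       triangles G < triangles G′
    triangles-strict {i} {j} {k} i<j j<k tri ¬tri =
      length-concatMap-strict mono₀ (∈-allFin i)
        (length-concatMap-strict (mono₁ i) (∈-allFin j)
          (length-concatMap-strict (mono₂ i j) (∈-allFin k)
            (length-if-strict (λ t → ¬tri (proj₂ (proj₂ (isTriangle⁻ G {i} {j} {k} t)))) (isTriangle⁺ G′ {i} {j} {k} i<j j<k tri))))

    private
      closeOrdered : ∀ {p q w} → toℕ p < toℕ q → p ≢ w → q ≢ w → ¬ Adj G p q →
                     Adj G′ p q → Adj G′ p w → Adj G′ q w → triangles G < triangles G′
      closeOrdered {p} {q} {w} p<q p≢w q≢w ¬pq pq pw qw with <-cmp (toℕ p) (toℕ w) | <-cmp (toℕ q) (toℕ w)
      ... | tri≈ _ e _   | _            = ⊥-elim (p≢w (toℕ-injective e))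
      ... | _            | tri≈ _ e _   = ⊥-elim (q≢w (toℕ-injective e))
      ... | tri> _ _ w<p | _            = triangles-strict w<p p<q (swap pw , pq , swap qw) (¬pq ∘ proj₁ ∘ proj₂)
      ... | tri< p<w _ _ | tri> _ _ w<q = triangles-strict p<w w<q (pw , swap qw , pq) (¬pq ∘ proj₂ ∘ proj₂)
      ... | tri< _ _ _   | tri< q<w _ _ = triangles-strict p<q q<w (pq , qw , pw) (¬pq ∘ proj₁)

    -- The count lists each triangle once, in increasing order of its vertices, so the place where
    -- the list gains an entry depends on the order of `p`, `q`, `w`. In every order the absence of
    -- `pq` from `G` shows that the entry is new.
    closeTriangle : ∀ {p q w} → p ≢ q → p ≢ w → q ≢ w → ¬ Adj G p q →
                    Adj G′ p q → Adj G′ p w → Adj G′ q w → triangles G < triangles G′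
    closeTriangle {p} {q} p≢q p≢w q≢w ¬pq pq pw qw with <-cmp (toℕ p) (toℕ q)
    ... | tri≈ _ e _   = ⊥-elim (p≢q (toℕ-injective e))
    ... | tri< p<q _ _ = closeOrdered p<q p≢w q≢w ¬pq pq pw qw
    ... | tri> _ _ q<p = closeOrdered q<p q≢w p≢w (¬pq ∘ swap) (swap pq) qw pw

  -- Constructor's graph only grows, so her triangles are never lost and the analysis may stop at
  -- any moment.
  triangles≤value : ∀ k b C (free : Vec (Edge n) k) → triangles C ≤ value k b C free
  triangles≤value zero b C free = ≤-refl
  triangles≤value (suc k) false C free = ≤-foldr₁-⊓ _ (λ i → triangles≤value k true C (removeAt free i))
  triangles≤value (suc k) true C free with filterᵇ (λ i → S4free (Vec.lookup free i ∷ C)) (allFin (suc k))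
  ... | [] = ≤-refl
  ... | i ∷ is = ≤-trans (triangles-mono {C} {Vec.lookup free i ∷ C} [ inj₁ ∘ there , inj₂ ∘ there ]′)
        (≤-trans (triangles≤value k false (Vec.lookup free i ∷ C) (removeAt free i))
          (≤-maxList (λ i → value k false (Vec.lookup free i ∷ C) (removeAt free i)) {xs = i ∷ is} (here refl)))

  adj⇒degree≢0 : ∀ (G : Graph n) {v x} → degree G v ≡ 0 → ¬ Adj G v x
  adj⇒degree≢0 G d vx = <⇒≱ (length≤degree G ([] ∷ []) (vx ∷ [])) (≤-reflexive d)

  degree-∷-≤ : ∀ (e : Edge n) G v → degree (e ∷ G) v ≤ suc (degree G v)
  degree-∷-≤ e G v with T? (incident v e)
  ... | yes t = ≤-reflexive (degree-incident e G v t)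
  ... | no ¬t = ≤-trans (≤-reflexive (degree-¬incident e G v ¬t)) (n≤1+n _)

  incident⁻ : ∀ v (a b : Fin n) → T (incident v (a , b)) → v ≡ a ⊎ v ≡ b
  incident⁻ v a b t with to (T-∨ {v =ᶠ a} {v =ᶠ b}) t
  ... | inj₁ h = inj₁ (toWitness {a? = v ≟ a} h)
  ... | inj₂ h = inj₂ (toWitness {a? = v ≟ b} h)

  -- Positions at Constructor's turn and one exchange of moves

  Joins : Fin n → Fin n → Edge n → Set
  Joins p q e = e ≡ (p , q) ⊎ e ≡ (q , p)

  degree-other : ∀ {p q e v} (G : Graph n) → Joins p q e → v ≢ p → v ≢ q → degree (e ∷ G) v ≡ degree G v
  degree-other {v = v} G (inj₁ refl) v≢p v≢q = degree-¬incident (_ , _) G v ([ v≢p , v≢q ]′ ∘ incident⁻ v _ _)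
  degree-other {v = v} G (inj₂ refl) v≢p v≢q = degree-¬incident (_ , _) G v ([ v≢q , v≢p ]′ ∘ incident⁻ v _ _)

  -- The graph B contains every edge claimed by Blocker.
  record Position : Set where
    field
      {k}      : ℕ
      C B      : Graph n
      free     : Vec (Edge n) k
      distinct : Distinct free
      sorted   : Sorted free
      disjoint : ∀ {p q} → Free free p q → ¬ Adj C p q
      cover    : ∀ {p q} → p ≢ q → Free free p q ⊎ Adj C p q ⊎ Adj B p q
      degree≤3 : ∀ v → degree C v ≤ 3

    payoff : ℕ
    payoff = value k true C free

  open Position

  -- One move of Constructor with its answer. `adj-only` is there for the negative information: a
  -- pair still absent from her graph and from Blocker's can be claimed.
  record Next (P P′ : Position) (p q : Fin n) : Set where
    field
      response    : Edge n
      adj-new     : Adj (C P′) p q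
      adj-old     : ∀ {a b} → Adj (C P) a b → Adj (C P′) a b
      adj-only    : ∀ {a b} → Adj (C P′) a b → Adj (C P) a b ⊎ Joins p q (a , b)
      degree-suc  : ∀ v → degree (C P′) v ≤ suc (degree (C P) v)
      degree-same : ∀ {v} → v ≢ p → v ≢ q → degree (C P′) v ≡ degree (C P) v
      blocked     : ∀ {a b} → Adj (B P′) a b → Adj (B P) a b ⊎ Joins a b response
      blocked-suc : ∀ v → degree (B P′) v ≤ suc (degree (B P) v)
      length-B    : length (B P′) ≡ suc (length (B P))

  module _ {P : Position} {p q : Fin n} (dp : degree (C P) p ≤ 2) (dq : degree (C P) q ≤ 2)
           {Φ : ℕ → Set} (cont : ∀ P′ → Next P P′ p q → Φ (payoff P′))
           {e : Edge n} (joins : Joins p q e) where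

    private
      C′ : Graph n
      C′ = e ∷ C P

      Disjoint′ : ∀ {m} → Vec (Edge n) m → Set
      Disjoint′ free′ = ∀ {a b} → Free free′ a b → ¬ Adj C′ a b

      Cover′ : ∀ {m} → Vec (Edge n) m → Graph n → Set
      Cover′ free′ B′ = ∀ {a b} → a ≢ b → Free free′ a b ⊎ Adj C′ a b ⊎ Adj B′ a b

    joined-S4free : ∀ v → degree C′ v ≤ 3
    joined-S4free v with v ≟ p | v ≟ q
    ... | yes refl | _ = ≤-trans (degree-∷-≤ e (C P) v) (s≤s dp)
    ... | no _ | yes refl = ≤-trans (degree-∷-≤ e (C P) v) (s≤s dq)
    ... | no v≢p | no v≢q = subst (_≤ 3) (sym (degree-other (C P) joins v≢p v≢q)) (degree≤3 P v)

    joined-only : ∀ {a b} → Adj C′ a b → Adj (C P) a b ⊎ Joins p q (a , b)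
    joined-only (inj₁ (there ab)) = inj₁ (inj₁ ab)
    joined-only (inj₂ (there ba)) = inj₁ (inj₂ ba)
    joined-only (inj₁ (here refl)) = inj₂ joins
    joined-only (inj₂ (here refl)) = inj₂ ([ (λ { refl → inj₂ refl }) , (λ { refl → inj₁ refl }) ]′ joins)

    private
      handOver : ∀ f {m} (free′ : Vec (Edge n) m) → Distinct free′ → Sorted free′ →
                 Disjoint′ free′ → Cover′ free′ (f ∷ B P) → Φ (value m true C′ free′)
      handOver f free′ dist sort dis cov = cont
        (record { C = C′ ; B = f ∷ B P ; free = free′ ; distinct = dist ; sorted = sort
                ; disjoint = dis ; cover = cov ; degree≤3 = joined-S4free })
        (record
          { response = f
          ; adj-new = [ (λ { refl → inj₁ (here refl) }) , (λ { refl → inj₂ (here refl) }) ]′ joins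
          ; adj-old = [ inj₁ ∘ there , inj₂ ∘ there ]′
          ; adj-only = joined-only
          ; degree-suc = degree-∷-≤ e (C P)
          ; degree-same = degree-other (C P) joins
          ; blocked = λ { (inj₁ (here refl)) → inj₂ (inj₁ refl) ; (inj₂ (here refl)) → inj₂ (inj₂ refl)
                        ; (inj₁ (there x)) → inj₁ (inj₁ x) ; (inj₂ (there x)) → inj₁ (inj₂ x) }
          ; blocked-suc = degree-∷-≤ f (B P)
          ; length-B = refl })

    -- When no edge is left the game is over; a spurious answer e of Blocker does no harm.
    blockerAnswers : ∀ {m} (free′ : Vec (Edge n) m) → Distinct free′ → Sorted free′ →
                     Disjoint′ free′ → Cover′ free′ (B P) → Φ (value m false C′ free′)
    blockerAnswers {zero} free′ dist sort dis cov = handOver e free′ dist sort dis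
      (λ a≢b → map₂⊎ (cov a≢b))
      where
        map₂⊎ : ∀ {X Y : Set} {a b} → X ⊎ Y ⊎ Adj (B P) a b → X ⊎ Y ⊎ Adj (e ∷ B P) a b
        map₂⊎ = [ inj₁ , [ inj₂ ∘ inj₁ , inj₂ ∘ inj₂ ∘ [ inj₁ ∘ there , inj₂ ∘ there ]′ ]′ ]′
    blockerAnswers {suc m} free′ dist sort dis cov = foldr₁-⊓-∈ Φ _ λ j →
      handOver (Vec.lookup free′ j) (removeAt free′ j) (removeAt-distinct free′ j dist) (removeAt-sorted free′ j sort)
        (dis ∘ [ inj₁ ∘ removeAt-unclaimed⁻ free′ j , inj₂ ∘ removeAt-unclaimed⁻ free′ j ]′)
        (λ a≢b → cover″ j (cov a≢b))
      where
        cover″ : ∀ j {a b} → Free free′ a b ⊎ Adj C′ a b ⊎ Adj (B P) a b →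
                 Free (removeAt free′ j) a b ⊎ Adj C′ a b ⊎ Adj (Vec.lookup free′ j ∷ B P) a b
        cover″ j (inj₂ (inj₁ c)) = inj₂ (inj₁ c)
        cover″ j (inj₂ (inj₂ b)) = inj₂ (inj₂ ([ inj₁ ∘ there , inj₂ ∘ there ]′ b))
        cover″ j {a} {b} (inj₁ (inj₁ f)) with (a , b) ≟ₑ Vec.lookup free′ j
        ... | yes eq = inj₂ (inj₂ (inj₁ (here eq)))
        ... | no ne = inj₁ (inj₁ (removeAt-unclaimed⁺ free′ j f ne))
        cover″ j {a} {b} (inj₁ (inj₂ f)) with (b , a) ≟ₑ Vec.lookup free′ j
        ... | yes eq = inj₂ (inj₂ (inj₂ (here eq)))
        ... | no ne = inj₁ (inj₂ (removeAt-unclaimed⁺ free′ j f ne))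

  -- Only one of Constructor's moves is followed, while `value` takes the maximum over all; hence
  -- `Φ` must be upward closed. Ends of degree at most 2 make the move legal.
  turn : ∀ P {p q} → Free (free P) p q → degree (C P) p ≤ 2 → degree (C P) q ≤ 2 →
         {Φ : ℕ → Set} → (∀ {a b} → a ≤ b → Φ a → Φ b) →
         (∀ P′ → Next P P′ p q → Φ (payoff P′)) → Φ (payoff P)
  turn (record { k = zero }) (inj₁ (() , _))
  turn (record { k = zero }) (inj₂ (() , _))
  turn P@(record { k = suc m ; C = C₀ ; B = B₀ ; free = free₀ }) {p} {q} pq dp dq {Φ} up cont =
    [ (λ (i , at-i) → move i (inj₁ at-i)) , (λ (i , at-i) → move i (inj₂ at-i)) ]′ pq
    where
      move : ∀ i → Joins p q (Vec.lookup free₀ i) → Φ (payoff P)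
      move i joins = up
        (≤-value-true C₀ free₀ i (degree≤3⇒S4free (e ∷ C₀) (joined-S4free {P} dp dq {Φ} cont joins)))
        (blockerAnswers {P} dp dq {Φ} cont joins (removeAt free₀ i) (removeAt-distinct free₀ i (distinct P))
          (removeAt-sorted free₀ i (sorted P))
          (λ f c → [ disjoint P (sub f) , (λ { (inj₁ refl) → gone f ; (inj₂ refl) → gone (swap f) }) ]′
                     (joined-only {P} dp dq {Φ} cont joins c))
          (λ a≢b → cover′ (cover P a≢b)))
        where
          e : Edge n
          e = Vec.lookup free₀ i
          sub : ∀ {a b} → Free (removeAt free₀ i) a b → Free free₀ a b
          sub = [ inj₁ ∘ removeAt-unclaimed⁻ free₀ i , inj₂ ∘ removeAt-unclaimed⁻ free₀ i ]′
          gone : ¬ Free (removeAt free₀ i) p q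
          gone = [ removeAt-gone₂ free₀ i (distinct P) (sorted P)
                 , (λ at-i → removeAt-gone₂ free₀ i (distinct P) (sorted P) at-i ∘ swap) ]′ joins
          cover′ : ∀ {a b} → Free free₀ a b ⊎ Adj C₀ a b ⊎ Adj B₀ a b →
                   Free (removeAt free₀ i) a b ⊎ Adj (e ∷ C₀) a b ⊎ Adj B₀ a b
          cover′ (inj₂ (inj₂ b)) = inj₂ (inj₂ b)
          cover′ (inj₂ (inj₁ c)) = inj₂ (inj₁ ([ inj₁ ∘ there , inj₂ ∘ there ]′ c))
          cover′ {a} {b} (inj₁ (inj₁ f)) with (a , b) ≟ₑ e
          ... | yes eq = inj₂ (inj₁ (inj₁ (here eq)))
          ... | no ne = inj₁ (inj₁ (removeAt-unclaimed⁺ free₀ i f ne))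
          cover′ {a} {b} (inj₁ (inj₂ f)) with (b , a) ≟ₑ e
          ... | yes eq = inj₂ (inj₁ (inj₂ (here eq)))
          ... | no ne = inj₁ (inj₂ (removeAt-unclaimed⁺ free₀ i f ne))

-- Rounds of Constructor's strategy

module _ {n : ℕ} (D : ℕ) where

  open Position
  open Next

  -- State after `s` rounds, with `R` the fresh vertices and `A` the reserve. A round takes at most
  -- four moves, hence `4 * s`. A reserve vertex gains two edges when used, hence its degree is at
  -- most 1 before. Its size exceeds by one the `3 * (2 + D)` vertices that Blocker can have joined
  -- to `c`, `x` or `y` by the time it is chosen: `D` for each before the round and two answers
  -- since.
  record Stage (P : Position {n}) (s : ℕ) (R A : List (Fin n)) : Set where
    field
      R-unique : Unique R
      A-unique : Unique A
      separate    : ∀ {v} → v ∈ R → v ∉ A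
      R-degree : ∀ {v} → v ∈ R → degree (C P) v ≡ 0
      A-degree : ∀ {v} → v ∈ A → degree (C P) v ≤ 1
      A-length : length A ≡ 7 + 3 * D
      B-length : length (B P) ≤ 4 * s
      found    : s ≤ triangles (C P)
      total    : n ≤ length R + length A + 3 * s

  open Stage

  -- This is `n ≤ 3 * v + (11 + 5 * D) + 8 * v / (D + 1)` without division. The constant is the
  -- reserve `7 + 3 * D` plus the at most `4 + 2 * D` good fresh vertices left over; the last term
  -- bounds the spoiled ones.
  Bound : ℕ → Set
  Bound v = suc D * n ≤ suc D * (3 * v + (11 + 5 * D)) + 8 * v

  bound-mono : ∀ {v w} → v ≤ w → Bound v → Bound w
  bound-mono v≤w b = ≤-trans b
    (+-mono-≤ (*-monoʳ-≤ (suc D) (+-monoˡ-≤ (11 + 5 * D) (*-monoʳ-≤ 3 v≤w))) (*-monoʳ-≤ 8 v≤w))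

  freeIf : ∀ (P : Position {n}) {p q} → p ≢ q → ¬ Adj (C P) p q → ¬ Adj (B P) p q → Free (free P) p q
  freeIf P p≢q ¬c ¬b with cover P p≢q
  ... | inj₁ f        = f
  ... | inj₂ (inj₁ c) = ⊥-elim (¬c c)
  ... | inj₂ (inj₂ b) = ⊥-elim (¬b b)

  notAdded : ∀ {P P′ : Position {n}} {p q a b} → Next P P′ p q → ¬ Adj (C P) a b →
             ¬ (a ≡ p × b ≡ q) → ¬ (a ≡ q × b ≡ p) → ¬ Adj (C P′) a b
  notAdded nx ¬ab f g ab with adj-only nx ab
  ... | inj₁ o           = ¬ab o
  ... | inj₂ (inj₁ refl) = f (refl , refl)
  ... | inj₂ (inj₂ refl) = g (refl , refl)

  remove₃ : (c x y : Fin n) → List (Fin n) → List (Fin n)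
  remove₃ c x y R = remove y (remove x (remove c R))

  ∈-remove₃⁻ : ∀ {c x y v R} → v ∈ remove₃ c x y R → v ∈ R × v ≢ c × v ≢ x × v ≢ y
  ∈-remove₃⁻ {c} {x} {y} {v} {R} v∈ =
    let v∈₂ , v≢y = ∈-remove⁻ {xs = remove x (remove c R)} v∈
        v∈₁ , v≢x = ∈-remove⁻ {xs = remove c R} v∈₂
        v∈R , v≢c = ∈-remove⁻ {xs = R} v∈₁
    in v∈R , v≢c , v≢x , v≢y

  remove-keeps : ∀ {v w : Fin n} {xs} → w ∈ xs → w ≢ v → w ∈ remove v xs
  remove-keeps {v} = ∈-filter⁺ (λ w → ¬? (w ≟ v))

  length-remove₃ : ∀ {c x y R} → Unique R → c ∈ R → x ∈ R → y ∈ R → c ≢ x → c ≢ y → x ≢ y →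
                   3 + length (remove₃ c x y R) ≡ length R
  length-remove₃ {c} {x} {y} {R} uniq c∈ x∈ y∈ c≢x c≢y x≢y = trans
    (cong (2 +_) (length-remove (remove-unique (remove-unique uniq))
      (remove-keeps (remove-keeps y∈ (≢-sym c≢y)) (≢-sym x≢y))))
    (trans (cong suc (length-remove (remove-unique uniq) (remove-keeps x∈ (≢-sym c≢x)))) (length-remove uniq c∈))

  ¬adj-neighbours : ∀ (G : Graph n) {v x} → x ∉ neighbours G v → ¬ Adj G v x
  ¬adj-neighbours G x∉ vx = x∉ (Adj⇒∈neighbours G vx)

  -- `L` holds the fresh vertices with few Blocker edges. The threshold `4 + 2 * D` serves the
  -- choice of `y`, which avoids `c`, `x` and at most `1 + D` Blocker neighbours of each.
  module Round {P : Position {n}} {s R A} (st : Stage P s R A) {L : List (Fin n)} (L-unique : Unique L)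
               (low : ∀ {v} → v ∈ L → v ∈ R × degree (B P) v ≤ D) (large : 4 + 2 * D < length L)
               (recur : ∀ P′ {s′ R′ A′} → Stage P′ s′ R′ A′ → length R′ < length R → Bound (payoff P′)) where

    module Path {P₁ P₂ : Position {n}} {c x y} (c∈ : c ∈ L) (x∈ : x ∈ L) (y∈ : y ∈ L)
                (c≢x : c ≢ x) (c≢y : c ≢ y) (x≢y : x ≢ y)
                (N₁ : Next P P₁ c x) (N₂ : Next P₁ P₂ c y) where

      R′ : List (Fin n)
      R′ = remove₃ c x y R

      length-R′ : 3 + length R′ ≡ length R
      length-R′ = length-remove₃ (R-unique st) (proj₁ (low c∈)) (proj₁ (low x∈)) (proj₁ (low y∈)) c≢x c≢y x≢y

      R′<R : length R′ < length R
      R′<R = ≤-trans (m≤n+m (suc (length R′)) 2) (≤-reflexive length-R′)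

      degree₀ : ∀ {v} → v ∈ L → degree (C P) v ≡ 0
      degree₀ v∈ = R-degree st (proj₁ (low v∈))

      isolated : ∀ {v w} → v ∈ L → ¬ Adj (C P) v w
      isolated v∈ = adj⇒degree≢0 (C P) (degree₀ v∈)

      degree-c₂ : degree (C P₂) c ≤ 2
      degree-c₂ = ≤-trans (degree-suc N₂ c) (s≤s (≤-trans (degree-suc N₁ c) (s≤s (≤-reflexive (degree₀ c∈)))))

      degree-x₂ : degree (C P₂) x ≤ 1
      degree-x₂ = ≤-trans (≤-reflexive (degree-same N₂ (≢-sym c≢x) x≢y))
        (≤-trans (degree-suc N₁ x) (s≤s (≤-reflexive (degree₀ x∈))))

      degree-y₂ : degree (C P₂) y ≤ 1
      degree-y₂ = ≤-trans (degree-suc N₂ y)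
        (s≤s (≤-reflexive (trans (degree-same N₁ (≢-sym c≢y) (≢-sym x≢y)) (degree₀ y∈))))

      degree-same₂ : ∀ {v} → v ≢ c → v ≢ x → v ≢ y → degree (C P₂) v ≡ degree (C P) v
      degree-same₂ v≢c v≢x v≢y = trans (degree-same N₂ v≢c v≢y) (degree-same N₁ v≢c v≢x)

      ¬xy₂ : ¬ Adj (C P₂) x y
      ¬xy₂ = notAdded N₂ (notAdded N₁ (isolated x∈) (c≢x ∘ sym ∘ proj₁) (c≢y ∘ sym ∘ proj₂))
               (c≢x ∘ sym ∘ proj₁) (x≢y ∘ proj₁)

      cx₂ : Adj (C P₂) c x
      cx₂ = adj-old N₂ (adj-new N₁)

      cy₂ : Adj (C P₂) c y
      cy₂ = adj-new N₂

      mono₂ : triangles (C P) ≤ triangles (C P₂)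
      mono₂ = triangles-mono (adj-old N₂ ∘ adj-old N₁)

      length-B₂ : length (B P₂) ≡ 2 + length (B P)
      length-B₂ = trans (length-B N₂) (cong suc (length-B N₁))

      -- Three moves suffice here and the reserve is untouched; `B-length` has one edge to spare.
      closed : Free (free P₂) x y → Bound (payoff P₂)
      closed xy = turn P₂ xy (m≤n⇒m≤1+n degree-x₂) (m≤n⇒m≤1+n degree-y₂) bound-mono λ P₃ N₃ →
        recur P₃ {suc s} {R′} {A} (record
          { R-unique = remove-unique (remove-unique (remove-unique (R-unique st)))
          ; A-unique = A-unique st
          ; separate = λ v∈ → separate st (proj₁ (∈-remove₃⁻ {R = R} v∈))
          ; R-degree = λ v∈ → let v∈R , v≢c , v≢x , v≢y = ∈-remove₃⁻ {R = R} v∈ in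
              trans (degree-same N₃ v≢x v≢y) (trans (degree-same₂ v≢c v≢x v≢y) (R-degree st v∈R))
          ; A-degree = λ v∈ →
              let v≢ : ∀ {w} → w ∈ L → _ ≢ w
                  v≢ w∈ = λ { refl → separate st (proj₁ (low w∈)) v∈ }
              in subst (_≤ 1) (sym (trans (degree-same N₃ (v≢ x∈) (v≢ y∈)) (degree-same₂ (v≢ c∈) (v≢ x∈) (v≢ y∈))))
                   (A-degree st v∈)
          ; A-length = A-length st
          ; B-length = ≤-trans (≤-reflexive (trans (length-B N₃) (cong suc length-B₂)))
              (≤-trans (n≤1+n _) (≤-trans (+-monoʳ-≤ 4 (B-length st)) (≤-reflexive (sym (*-suc 4 s)))))
          ; found = ≤-trans (s≤s (≤-trans (found st) mono₂))
              (closeTriangle (adj-old N₃) x≢y (≢-sym c≢x) (≢-sym c≢y) ¬xy₂ (adj-new N₃)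
                (adj-old N₃ (swap cx₂)) (adj-old N₃ (swap cy₂)))
          ; total = ≤-trans (total st) (≤-reflexive (trans (cong (λ r → r + length A + 3 * s) (sym length-R′))
              (shift (length R′) (length A) s)))
          }) R′<R
        where
          shift : ∀ r a s → 3 + r + a + 3 * s ≡ r + a + 3 * suc s
          shift = solve-∀

      module Star {P₃ : Position {n}} {a} (a∈ : a ∈ A) (N₃ : Next P₂ P₃ c a) where

        a≢ : ∀ {v} → v ∈ L → a ≢ v
        a≢ v∈ refl = separate st (proj₁ (low v∈)) a∈

        -- Stated for `w` and `z` as `x` and `y` in either order: `w` closes the triangle with `c`
        -- and `a`, while `z` keeps only its edge to `c` and takes the place of `a` in the reserve.
        closing : ∀ {w z} → w ∈ L → z ∈ L → w ≢ z → c ≢ w → c ≢ z → degree (C P₂) w ≤ 1 → degree (C P₂) z ≤ 1 →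
                  Adj (C P₂) c w → ¬ Adj (C P₂) w a →
                  (∀ {v} → v ≢ x → v ≢ y → v ≢ w × v ≢ z) →
                  Free (free P₃) w a → Bound (payoff P₃)
        closing {w} {z} w∈ z∈ w≢z c≢w c≢z dw dz cw ¬wa fromXY wa =
          turn P₃ wa (m≤n⇒m≤1+n (subst (_≤ 1) (sym (degree-same N₃ (≢-sym c≢w) (≢-sym (a≢ w∈)))) dw))
            (≤-trans (degree-suc N₃ a) (s≤s (subst (_≤ 1) (sym degree-a) (A-degree st a∈))))
            bound-mono λ P₄ N₄ → recur P₄ {suc s} {R′} {z ∷ remove a A} (record
              { R-unique = remove-unique (remove-unique (remove-unique (R-unique st)))
              ; A-unique = All.tabulate (λ v∈ → λ { refl → separate st (proj₁ (low z∈)) (proj₁ (∈-remove⁻ {xs = A} v∈)) })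
                           ∷ remove-unique (A-unique st)
              ; separate = λ { v∈ (here refl) → let _ , _ , v≢x , v≢y = ∈-remove₃⁻ {R = R} v∈ in
                                             proj₂ (fromXY v≢x v≢y) refl
                          ; v∈ (there v∈A) → separate st (proj₁ (∈-remove₃⁻ {R = R} v∈)) (proj₁ (∈-remove⁻ {xs = A} v∈A)) }
              ; R-degree = λ v∈ → let v∈R , v≢c , v≢x , v≢y = ∈-remove₃⁻ {R = R} v∈
                                      v≢a = λ { refl → separate st v∈R a∈ } in
                  trans (degree-same N₄ (proj₁ (fromXY v≢x v≢y)) v≢a)
                    (trans (degree-same N₃ v≢c v≢a) (trans (degree-same₂ v≢c v≢x v≢y) (R-degree st v∈R)))
              ; A-degree = λ { (here refl) → subst (_≤ 1)
                                 (sym (trans (degree-same N₄ (≢-sym w≢z) (≢-sym (a≢ z∈)))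
                                             (degree-same N₃ (≢-sym c≢z) (≢-sym (a≢ z∈))))) dz
                             ; (there v∈) → old-A-degree P₄ N₄ v∈ }
              ; A-length = trans (length-remove (A-unique st) a∈) (A-length st)
              ; B-length = ≤-trans (≤-reflexive (trans (length-B N₄) (cong suc (trans (length-B N₃) (cong suc length-B₂)))))
                  (≤-trans (+-monoʳ-≤ 4 (B-length st)) (≤-reflexive (sym (*-suc 4 s))))
              ; found = ≤-trans (s≤s (≤-trans (found st) (≤-trans mono₂ (triangles-mono (adj-old N₃)))))
                  (closeTriangle (adj-old N₄) (≢-sym (a≢ w∈)) (≢-sym c≢w) (a≢ c∈)
                    (notAdded N₃ ¬wa (c≢w ∘ sym ∘ proj₁) (a≢ w∈ ∘ sym ∘ proj₁))
                    (adj-new N₄) (adj-old N₄ (adj-old N₃ (swap cw))) (adj-old N₄ (swap (adj-new N₃))))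
              ; total = ≤-trans (total st) (≤-reflexive (trans
                  (cong₂ (λ r l → r + l + 3 * s) (sym length-R′) (sym (length-remove (A-unique st) a∈)))
                  (shift (length R′) (length (remove a A)) s)))
              }) R′<R
          where
            degree-a : degree (C P₂) a ≡ degree (C P) a
            degree-a = degree-same₂ (a≢ c∈) (a≢ x∈) (a≢ y∈)
            old-A-degree : ∀ P₄ → Next P₃ P₄ w a → ∀ {v} → v ∈ remove a A → degree (C P₄) v ≤ 1
            old-A-degree P₄ N₄ {v} v∈ =
              let v∈A , v≢a = ∈-remove⁻ {xs = A} v∈
                  v≢ : ∀ {u} → u ∈ L → v ≢ u
                  v≢ u∈ = λ { refl → separate st (proj₁ (low u∈)) v∈A }
              in subst (_≤ 1) (sym (trans (degree-same N₄ (v≢ w∈) v≢a) (trans (degree-same N₃ (v≢ c∈) v≢a)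
                   (degree-same₂ (v≢ c∈) (v≢ x∈) (v≢ y∈))))) (A-degree st v∈A)
            shift : ∀ r a s → 3 + r + suc a + 3 * s ≡ r + suc a + 3 * suc s
            shift = solve-∀

        ¬va₂ : ∀ {v} → v ∈ L → v ≢ c → ¬ Adj (C P₂) v a
        ¬va₂ v∈ v≢c = notAdded N₂ (notAdded N₁ (isolated v∈) (v≢c ∘ proj₁) (a≢ c∈ ∘ proj₂))
                        (v≢c ∘ proj₁) (a≢ c∈ ∘ proj₂)

        ¬va₃ : ∀ {v} → v ∈ L → v ≢ c → ¬ Adj (C P₃) v a
        ¬va₃ v∈ v≢c = notAdded N₃ (¬va₂ v∈ v≢c) (v≢c ∘ proj₁) (a≢ v∈ ∘ sym ∘ proj₁)

        -- Blocker's single answer cannot take both xa and ya.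
        star : ¬ Adj (B P₂) x a → ¬ Adj (B P₂) y a → Bound (payoff P₃)
        star ¬xa ¬ya with adj? (B P₃) x a
        ... | no ¬xa₃ = closing x∈ y∈ x≢y c≢x c≢y degree-x₂ degree-y₂ cx₂ (¬va₂ x∈ (≢-sym c≢x))
                _,_
                (freeIf P₃ (≢-sym (a≢ x∈)) (¬va₃ x∈ (≢-sym c≢x)) ¬xa₃)
        ... | yes xa₃ = closing y∈ x∈ (≢-sym x≢y) c≢y c≢x degree-y₂ degree-x₂ cy₂ (¬va₂ y∈ (≢-sym c≢y))
                (λ p q → q , p)
                (freeIf P₃ (≢-sym (a≢ y∈)) (¬va₃ y∈ (≢-sym c≢y)) ¬ya₃)
          where
            same : ∀ {f : Edge n} → Joins x a f → Joins y a f → x ≡ y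
            same (inj₁ refl) (inj₁ refl) = refl
            same (inj₁ refl) (inj₂ refl) = ⊥-elim (a≢ x∈ refl)
            same (inj₂ refl) (inj₁ refl) = ⊥-elim (a≢ y∈ refl)
            same (inj₂ refl) (inj₂ refl) = refl
            ¬ya₃ : ¬ Adj (B P₃) y a
            ¬ya₃ ya₃ with blocked N₃ xa₃ | blocked N₃ ya₃
            ... | inj₁ xa | _       = ¬xa xa
            ... | inj₂ _  | inj₁ ya = ¬ya ya
            ... | inj₂ jx | inj₂ jy = x≢y (same jx jy)

      continue : Bound (payoff P₂)
      continue with cover P₂ x≢y
      ... | inj₁ xy = closed xy
      ... | inj₂ (inj₁ xy) = ⊥-elim (¬xy₂ xy)
      ... | inj₂ (inj₂ _) with pick (A-unique st) forbidden few
        where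
          B₂ : Graph n
          B₂ = B P₂
          forbidden : List (Fin n)
          forbidden = neighbours B₂ c ++ neighbours B₂ x ++ neighbours B₂ y
          bound : ∀ {v} → v ∈ L → length (neighbours B₂ v) ≤ 2 + D
          bound {v} v∈ = ≤-trans (≤-reflexive (length-neighbours B₂ v))
            (≤-trans (blocked-suc N₂ v) (s≤s (≤-trans (blocked-suc N₁ v) (s≤s (proj₂ (low v∈))))))
          few : length forbidden < length A
          few rewrite length-++ (neighbours B₂ c) {neighbours B₂ x ++ neighbours B₂ y}
                    | length-++ (neighbours B₂ x) {neighbours B₂ y} | A-length st =
            s≤s (≤-trans (+-mono-≤ (bound c∈) (+-mono-≤ (bound x∈) (bound y∈))) (≤-reflexive (sizes D)))
            where sizes : ∀ d → (2 + d) + ((2 + d) + (2 + d)) ≡ 6 + 3 * d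
                  sizes = solve-∀
      ... | a , a∈ , a∉ = turn P₂ (freeIf P₂ (≢-sym (a≢′ c∈)) ¬ca (¬adj-neighbours (B P₂) (a∉ ∘ ∈-++⁺ˡ)))
              degree-c₂
              (≤-trans (≤-reflexive (degree-same₂ (a≢′ c∈) (a≢′ x∈) (a≢′ y∈))) (m≤n⇒m≤1+n (A-degree st a∈)))
              bound-mono λ P₃ N₃ → Star.star a∈ N₃
                (¬adj-neighbours (B P₂) (a∉ ∘ ∈-++⁺ʳ (neighbours (B P₂) c) ∘ ∈-++⁺ˡ))
                (¬adj-neighbours (B P₂) (a∉ ∘ ∈-++⁺ʳ (neighbours (B P₂) c) ∘ ∈-++⁺ʳ (neighbours (B P₂) x)))
        where
          a≢′ : ∀ {v} → v ∈ L → a ≢ v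
          a≢′ v∈ refl = separate st (proj₁ (low v∈)) a∈
          ¬ca : ¬ Adj (C P₂) c a
          ¬ca = notAdded N₂ (notAdded N₁ (isolated c∈) (a≢′ x∈ ∘ proj₂) (a≢′ c∈ ∘ proj₂))
                  (a≢′ y∈ ∘ proj₂) (a≢′ c∈ ∘ proj₂)

    round : Bound (payoff P)
    round with pick L-unique [] (≤-trans (s≤s z≤n) large)
    ... | c , c∈ , _ with pick L-unique (c ∷ neighbours (B P) c) few
      where
        few : length (c ∷ neighbours (B P) c) < length L
        few = ≤-trans (s≤s (s≤s (≤-trans (≤-reflexive (length-neighbours (B P) c)) (proj₂ (low c∈)))))
          (≤-trans (+-mono-≤ (m≤m+n 2 3) (m≤m+n D (D + 0))) large)
    ... | x , x∈ , x∉ = turn P (freeIf P c≢x (isolated c∈) (¬adj-neighbours (B P) (x∉ ∘ there)))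
            (≤-trans (≤-reflexive (degree₀ c∈)) z≤n) (≤-trans (≤-reflexive (degree₀ x∈)) z≤n) bound-mono second
      where
        c≢x : c ≢ x
        c≢x refl = x∉ (here refl)
        degree₀ : ∀ {v} → v ∈ L → degree (C P) v ≡ 0
        degree₀ v∈ = R-degree st (proj₁ (low v∈))
        isolated : ∀ {v w} → v ∈ L → ¬ Adj (C P) v w
        isolated v∈ = adj⇒degree≢0 (C P) (degree₀ v∈)
        second : ∀ P₁ → Next P P₁ c x → Bound (payoff P₁)
        second P₁ N₁ with pick L-unique (c ∷ x ∷ neighbours (B P₁) c ++ neighbours (B P₁) x) few
          where
            bound : ∀ {v} → v ∈ L → length (neighbours (B P₁) v) ≤ 1 + D
            bound {v} v∈ = ≤-trans (≤-reflexive (length-neighbours (B P₁) v))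
              (≤-trans (blocked-suc N₁ v) (s≤s (proj₂ (low v∈))))
            few : length (c ∷ x ∷ neighbours (B P₁) c ++ neighbours (B P₁) x) < length L
            few rewrite length-++ (neighbours (B P₁) c) {neighbours (B P₁) x} =
              ≤-trans (s≤s (s≤s (s≤s (≤-trans (+-mono-≤ (bound c∈) (bound x∈)) (≤-reflexive (sizes D)))))) large
              where sizes : ∀ d → (1 + d) + (1 + d) ≡ 2 + 2 * d
                    sizes = solve-∀
        ... | y , y∈ , y∉ = turn P₁ (freeIf P₁ c≢y ¬cy (¬adj-neighbours (B P₁) (y∉ ∘ there ∘ there ∘ ∈-++⁺ˡ)))
                (≤-trans (degree-suc N₁ c) (s≤s (≤-trans (≤-reflexive (degree₀ c∈)) z≤n)))
                (≤-trans (≤-reflexive (trans (degree-same N₁ (≢-sym c≢y) (≢-sym x≢y)) (degree₀ y∈))) z≤n)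
                bound-mono λ P₂ N₂ → Path.continue c∈ x∈ y∈ c≢x c≢y x≢y N₁ N₂
          where
            c≢y : c ≢ y
            c≢y refl = y∉ (here refl)
            x≢y : x ≢ y
            x≢y refl = y∉ (there (here refl))
            ¬cy : ¬ Adj (C P₁) c y
            ¬cy = notAdded N₁ (isolated c∈) (x≢y ∘ sym ∘ proj₂) (c≢x ∘ proj₁)

  -- Counting the vertices with few Blocker edges

  swap₁₂ : ∀ d l s → d + (l + s) ≡ l + (d + s)
  swap₁₂ = solve-∀

  isLow? : ∀ (B : Graph n) v → Dec (degree B v ≤ D)
  isLow? B v = degree B v ≤? D

  -- The handshake count: an edge adds to the degree of its two ends only, and each of them occurs
  -- in `R` at most once.
  sum-degrees : ∀ (B : Graph n) {R} → Unique R → sum (map (degree B) R) ≤ 2 * length B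
  sum-degrees [] {R} uniq = ≤-reflexive (zeros R)
    where zeros : ∀ R → sum (map (degree {n} []) R) ≡ 0
          zeros [] = refl
          zeros (_ ∷ R) = zeros R
  sum-degrees (e@(a , b) ∷ B) {R} uniq = ≤-trans (split R)
    (≤-trans (+-mono-≤ ends (sum-degrees B uniq)) (≤-reflexive (sym (*-suc 2 (length B)))))
    where
      inc? : ∀ v → Dec (T (incident v e))
      inc? v = T? (incident v e)
      split : ∀ R → sum (map (degree (e ∷ B)) R) ≤ length (filter inc? R) + sum (map (degree B) R)
      split [] = z≤n
      split (v ∷ R) with incident v e
      ... | true = s≤s (≤-trans (+-monoʳ-≤ (degree B v) (split R)) (≤-reflexive
              (swap₁₂ (degree B v) (length (filter inc? R)) (sum (map (degree B) R)))))
      ... | false = ≤-trans (+-monoʳ-≤ (degree B v) (split R)) (≤-reflexive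
              (swap₁₂ (degree B v) (length (filter inc? R)) (sum (map (degree B) R))))
      ends : length (filter inc? R) ≤ 2
      ends = unique-⊆⇒length≤ {ys = a ∷ b ∷ []} (filter⁺ inc? uniq) (λ {v} v∈ →
        [ (λ { refl → here refl }) , (λ { refl → there (here refl) }) ]′
          (incident⁻ v a b (proj₂ (∈-filter⁻ inc? {xs = R} v∈))))

  -- Markov's inequality: every vertex removed by the filter contributes at least `suc D` to the sum
  -- of degrees.
  mostAreLow : ∀ (B : Graph n) R → suc D * length R ≤ suc D * length (filter (isLow? B) R) + sum (map (degree B) R)
  mostAreLow B [] = ≤-trans (≤-reflexive (*-zeroʳ (suc D))) z≤n
  mostAreLow B (v ∷ R) with degree B v ≤ᵇ D | ≤⇒≤ᵇ {degree B v} {D}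
  ... | true | _ =
          ≤-trans (≤-reflexive (*-suc (suc D) (length R))) (≤-trans (+-monoʳ-≤ (suc D) (mostAreLow B R))
          (≤-trans (+-monoʳ-≤ (suc D) (+-monoʳ-≤ (suc D * l) (m≤n+m t (degree B v))))
            (≤-reflexive (trans (sym (+-assoc (suc D) (suc D * l) (degree B v + t))) (cong (_+ (degree B v + t)) (sym (*-suc (suc D) l)))))))
    where l = length (filter (isLow? B) R)
          t = sum (map (degree B) R)
  ... | false | high =
          ≤-trans (≤-reflexive (*-suc (suc D) (length R))) (≤-trans (+-mono-≤ (≰⇒> high) (mostAreLow B R))
          (≤-reflexive (swap₁₂ (degree B v) (suc D * length (filter (isLow? B) R)) (sum (map (degree B) R)))))

  stop : ∀ {P s R A} → Stage P s R A → length (filter (isLow? (B P)) R) ≤ 4 + 2 * D → Bound (payoff P)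
  stop {P} {s} {R} {A} st few = bound-mono
    (≤-trans (found st) (triangles≤value (k P) true (C P) (free P))) (begin
    suc D * n ≤⟨ *-monoʳ-≤ (suc D) (total st) ⟩
    suc D * (length R + length A + 3 * s) ≡⟨ cong (λ l → suc D * (length R + l + 3 * s)) (A-length st) ⟩
    suc D * (length R + (7 + 3 * D) + 3 * s) ≡⟨ expand D (length R) s ⟩
    suc D * length R + suc D * ((7 + 3 * D) + 3 * s) ≤⟨ +-monoˡ-≤ _ (mostAreLow (B P) R) ⟩
    suc D * length (filter (isLow? (B P)) R) + sum (map (degree (B P)) R) + suc D * ((7 + 3 * D) + 3 * s)
      ≤⟨ +-monoˡ-≤ _ (+-mono-≤ (*-monoʳ-≤ (suc D) few) (≤-trans (sum-degrees (B P) (R-unique st)) (*-monoʳ-≤ 2 (B-length st)))) ⟩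
    suc D * (4 + 2 * D) + 2 * (4 * s) + suc D * ((7 + 3 * D) + 3 * s) ≡⟨ collect D s ⟩
    suc D * (3 * s + (11 + 5 * D)) + 8 * s ∎)
    where
      open ≤-Reasoning
      expand : ∀ d r s → suc d * (r + (7 + 3 * d) + 3 * s) ≡ suc d * r + suc d * ((7 + 3 * d) + 3 * s)
      expand = solve-∀
      collect : ∀ d s → suc d * (4 + 2 * d) + 2 * (4 * s) + suc d * ((7 + 3 * d) + 3 * s)
                      ≡ suc d * (3 * s + (11 + 5 * d)) + 8 * s
      collect = solve-∀

  -- Each round takes three vertices out of `R`, so the length of `R` is enough fuel.
  play : ∀ fuel P {s R A} → Stage P s R A → length R ≤ fuel → Bound (payoff P)
  play zero P {R = R} st le = stop st (≤-trans (length-filter (isLow? (B P)) R) (≤-trans le z≤n))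
  play (suc fuel) P {R = R} st le with length (filter (isLow? (B P)) R) ≤? 4 + 2 * D
  ... | yes few = stop st few
  ... | no many = Round.round st (filter⁺ (isLow? (B P)) (R-unique st))
          (λ v∈ → ∈-filter⁻ (isLow? (B P)) {xs = R} v∈) (≰⇒> many)
          (λ P′ st′ lt → play fuel P′ st′ (≤-pred (≤-trans lt le)))

  initial : Position {n}
  initial = record
    { C = [] ; B = [] ; free = start n ; distinct = start-distinct n ; sorted = start-sorted n
    ; disjoint = λ { _ (inj₁ ()) ; _ (inj₂ ()) } ; cover = λ p≢q → inj₁ (all-free p≢q)
    ; degree≤3 = λ _ → z≤n }
    where
      unclaimed : ∀ {A : Set} {x : A} (xs : List A) → x ∈ xs → ∃[ i ] (Vec.lookup (Vec.fromList xs) i ≡ x)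
      unclaimed (_ ∷ _) (here refl) = zero , refl
      unclaimed (_ ∷ xs) (there x∈) = let i , e = unclaimed xs x∈ in suc i , e
      all-free : ∀ {p q} → p ≢ q → Free (start n) p q
      all-free {p} {q} p≢q with <-cmp (toℕ p) (toℕ q)
      ... | tri< p<q _ _ = inj₁ (unclaimed (edgesK n) (∈-edgesK⁺ p<q))
      ... | tri≈ _ e _   = ⊥-elim (p≢q (toℕ-injective e))
      ... | tri> _ _ q<p = inj₂ (unclaimed (edgesK n) (∈-edgesK⁺ q<p))

  g-bound : Bound (g n)
  g-bound with 7 + 3 * D ≤? n
  -- Too few vertices for a reserve, but then `n` is below the additive constant `11 + 5 * D`.
  ... | no small = ≤-trans (*-monoʳ-≤ (suc D) (≤-trans (<⇒≤ (≰⇒> small))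
          (≤-trans (+-mono-≤ (m≤m+n 7 4) (*-monoˡ-≤ D (m≤m+n 3 2))) (m≤n+m (11 + 5 * D) (3 * g n))))) (m≤m+n _ _)
  ... | yes m≤n = play (length R) initial {s = 0} {R} {A} (record
          { R-unique = filter⁺ (λ v → ¬? (v ∈? A)) (allFin⁺ n)
          ; A-unique = map⁺ (inject≤-injective m≤n m≤n _ _) (allFin⁺ m)
          ; separate = λ v∈R → proj₂ (∈-filter⁻ (λ v → ¬? (v ∈? A)) {xs = allFin n} v∈R)
          ; R-degree = λ _ → refl ; A-degree = λ _ → z≤n
          ; A-length = trans (length-map (λ i → inject≤ i m≤n) (allFin m)) (length-tabulate id)
          ; B-length = z≤n ; found = z≤n
          ; total = ≤-trans (≤-trans (≤-reflexive (sym (length-tabulate {n = n} id)))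
                      (≤-trans (unique-⊆⇒length≤ (allFin⁺ n) all-in) (≤-reflexive (length-++ R))))
                      (m≤m+n _ _)
          }) ≤-refl
    where
      open import Data.List.Membership.DecPropositional (_≟_ {n}) using (_∈?_)
      m : ℕ
      m = 7 + 3 * D
      A R : List (Fin n)
      A = map (λ i → inject≤ i m≤n) (allFin m)
      R = filter (λ v → ¬? (v ∈? A)) (allFin n)
      all-in : ∀ {v} → v ∈ allFin n → v ∈ R ++ A
      all-in {v} v∈ with v ∈? A
      ... | yes v∈A = ∈-++⁺ʳ R v∈A
      ... | no v∉A = ∈-++⁺ˡ (∈-filter⁺ (λ v → ¬? (v ∈? A)) v∈ v∉A)

-- The `1 + o(1)` is spelled out with precision `1 / (k + 1)`, cleared of denominators.
theorem1p3 : (k : ℕ) → ∃[ N ] ((n : ℕ) → N ≤ n → suc k * ∣ 3 * g n - n ∣ ≤ n)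
theorem1p3 k = 2 * suc k * K , λ n N≤n → close n N≤n
  where
    -- `suc D` is `6 * suc k`, so `g-bound` gives `6 * suc k * d ≤ 6 * suc k * K + 8 * v`. The
    -- threshold on `n` makes the first term at most `3 * n`, and the upper bound gives
    -- `8 * v ≤ 9 * v ≤ 3 * n`. The total `6 * n` cancels the factor 6.
    D K : ℕ
    D = 5 + 6 * k
    K = 11 + 5 * D
    close : ∀ n → 2 * suc k * K ≤ n → suc k * ∣ 3 * g n - n ∣ ≤ n
    close n N≤n rewrite m≤n⇒∣m-n∣≡n∸m (3*g≤n n) = *-cancelˡ-≤ 6 (+-cancelˡ-≤ (6 * suc k * (3 * v)) _ _ (begin
      6 * suc k * (3 * v) + 6 * (suc k * d) ≡⟨ gather k v d ⟩
      suc D * (d + 3 * v) ≡⟨ cong (suc D *_) (m∸n+n≡m (3*g≤n n)) ⟩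
      suc D * n ≤⟨ g-bound {n} D ⟩
      suc D * (3 * v + K) + 8 * v ≡⟨ spread k v K ⟩
      6 * suc k * (3 * v) + (3 * (2 * suc k * K) + 8 * v)
        ≤⟨ +-monoʳ-≤ (6 * suc k * (3 * v)) (+-mono-≤ (*-monoʳ-≤ 3 N≤n)
             (≤-trans (*-monoˡ-≤ v (n≤1+n 8)) (≤-trans (≤-reflexive (*-assoc 3 3 v)) (*-monoʳ-≤ 3 (3*g≤n n))))) ⟩
      6 * suc k * (3 * v) + (3 * n + 3 * n) ≡⟨ cong (6 * suc k * (3 * v) +_) (sym (*-distribʳ-+ n 3 3)) ⟩
      6 * suc k * (3 * v) + 6 * n ∎))
      where
        open ≤-Reasoning
        v d : ℕ
        v = g n
        d = n ∸ 3 * v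
        gather : ∀ k v d → 6 * suc k * (3 * v) + 6 * (suc k * d) ≡ suc (5 + 6 * k) * (d + 3 * v)
        gather = solve-∀
        spread : ∀ k v K → suc (5 + 6 * k) * (3 * v + K) + 8 * v ≡ 6 * suc k * (3 * v) + (3 * (2 * suc k * K) + 8 * v)
        spread = solve-∀
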